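{- For every $\varepsilon>0$ there exists $d_0$ such that every finite simple graph $G$ with minimum degree $d\geq d_0$ satisfies $\vec{\chi}_{\ell}(G)\geq \left(\tfrac{1}{3}-\varepsilon\right)\log_2 d$. (That is, every graph $G$ with minimum degree $d$ satisfies $\vec{\chi}_{\ell}(G)\geq(\tfrac13-o(1))\log_2 d$, where $o(1)\to 0$ as $d\to\infty$.)
   Context: A digraph $D$ is an orientation of a graph $G$ if its underlying graph is $G$ and it has at most one arc between each pair of vertices. A $k$-list assignment $L$ of a digraph $D$ assigns to each vertex $v$ a finite set $L(v)$ of at least $k$ positive integers. An $L$-dicolouring of $D$ is a function $\varphi:V(D)\to\mathbb{Z}^+$ with $\varphi(v)\in L(v)$ for all $v$ such that for each $i$ the subdigraph induced by $\varphi^{ -1}(i)$ has no directed cycle. The dichoosability $\vec{\chi}_{\ell}(D)$ is the least $k$ such that for every $k$-list assignment $L$ of $D$, $D$ admits an $L$-dicolouring. For a graph $G$, $\vec{\chi}_{\ell}(G)$ is the maximum of $\vec{\chi}_{\ell}(D)$ over all orientations $D$ of $G$. -}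

module Defs where

open import Data.Nat using (ℕ; zero; suc; _+_; _*_; _∸_; _^_; _≤_; _<_)
open import Data.Bool using (Bool; true; false)
open import Data.Fin using (Fin; inject₁; fromℕ) renaming (zero to fzero; suc to fsuc)
open import Data.List using (List; length; filterᵇ; allFin)
open import Data.List.Membership.Propositional using (_∈_)
open import Data.List.Relation.Unary.All using (All)
open import Data.List.Relation.Unary.Unique.Propositional using (Unique)
open import Data.Product using (Σ; ∃; _×_)
open import Data.Sum using (_⊎_)
open import Data.Empty using (⊥)
open import Relation.Nullary using (¬_)
open import Relation.Binary.PropositionalEquality using (_≡_)
open import Function.Definitions using (Injective)

record Graph (n : ℕ) : Set where
  field
    adj   : Fin n → Fin n → Bool
    sym   : ∀ u v → adj u v ≡ adj v u
    irrefl : ∀ v → adj v v ≡ false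
open Graph public

degree : ∀ {n} → Graph n → Fin n → ℕ
degree {n} G v = length (filterᵇ (adj G v) (allFin n))

MinDegree : ∀ {n} → Graph n → ℕ → Set
MinDegree G d = (∀ v → d ≤ degree G v) × (∃ λ v → degree G v ≡ d)

record Orientation {n : ℕ} (G : Graph n) : Set₁ where
  field
    arc      : Fin n → Fin n → Set
    arc⇒adj  : ∀ u v → arc u v → adj G u v ≡ true
    adj⇒arc  : ∀ u v → adj G u v ≡ true → arc u v ⊎ arc v u
    antisym  : ∀ u v → arc u v → arc v u → ⊥
open Orientation public

DirectedCycleIn : ∀ {n} {G : Graph n} → Orientation G → (Fin n → Set) → Set
DirectedCycleIn {n} D S =
  Σ ℕ λ l → Σ (Fin (suc l) → Fin n) λ c →
    Injective _≡_ _≡_ c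
    × (∀ (i : Fin l) → arc D (c (inject₁ i)) (c (fsuc i)))
    × arc D (c (fromℕ l)) (c fzero)
    × (∀ i → S (c i))

IsListAssignment : ∀ {n} → ℕ → (Fin n → List ℕ) → Set
IsListAssignment k L = ∀ v → Unique (L v) × (k ≤ length (L v)) × All (λ c → 1 ≤ c) (L v)

IsLDicolouring : ∀ {n} {G : Graph n} → Orientation G → (Fin n → List ℕ) → (Fin n → ℕ) → Set
IsLDicolouring D L φ =
  (∀ v → φ v ∈ L v) × (∀ i → ¬ DirectedCycleIn D (λ v → φ v ≡ i))

Dichoosable : ∀ {n} {G : Graph n} → Orientation G → ℕ → Set
Dichoosable {n} D k =
  (L : Fin n → List ℕ) → IsListAssignment k L → Σ (Fin n → ℕ) λ φ → IsLDicolouring D L φ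

-- "(1/3 - m/n) · log₂ d ≤ k" for naturals m, n (n ≥ 1), d ≥ 1, k:
-- multiplying by 3n this is (n - 3m) log₂ d ≤ 3nk, i.e. d^(n-3m) ≤ 2^(3nk)
-- when 3m < n, and trivially true when 3m ≥ n (left side ≤ 0).
LogBound : (m n d k : ℕ) → Set
LogBound m n d k = d ^ (n ∸ 3 * m) ≤ 2 ^ (3 * n * k)

{-# OPTIONS --safe #-}

-- The lists come from a monotone Boolean function all of whose minterms and maxterms have κ variables:
-- any set of variables contains a minterm or avoids a maxterm.  An AND/OR tree has at most 2^κ minterms
-- and 4^κ maxterms up to a 2^O(1) factor, and d only has to exceed their product by a polynomial in κ;
-- this is where 8^κ ≈ d, i.e. κ ≈ (1/3) log₂ d, comes from.
--
-- A sparse random set B receives maxterms as lists, so that most vertices outside B see every maxterm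
-- κ t times on B.  Once B is coloured, the colours occurring at least t times around such a vertex a
-- meet every maxterm, hence contain a minterm; a is stuck if it was given that minterm, because then any
-- colour for a creates t monochromatic edges into B.  In a random orientation a fixed colouring of B
-- and of the stuck vertices is acyclic with probability at most (2κ)^(-#stuck) 2^|B|, since an r-edge
-- graph on v vertices has few acyclic orientations (a(H) = a(H - e) + a(H / e)), and for random minterms
-- enough vertices are stuck to beat the union bound over the colourings of B.
module Submission where

open import Defs hiding (sym)
import Defs
open import Algebra.Properties.CommutativeSemigroup using (interchange; xy∙z≈xz∙y)
open import Data.Bool using (Bool; true; false; if_then_else_; _∧_; _∨_; not)
open import Data.Bool.Properties using (not-involutive; ∨-zeroʳ) renaming (_≟_ to _≟ᵇ_)
open import Data.Empty using (⊥)
open import Data.Fin using (Fin; zero; suc; toℕ; fromℕ; inject₁; _↑ˡ_; _↑ʳ_; splitAt; join; combine; remQuot; punchIn; punchOut; _≟_)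
open import Data.Fin.Patterns using (0F; 1F)
open import Data.Fin.Properties using (toℕ-injective; toℕ<n; toℕ-inject₁; toℕ-fromℕ; ↑ˡ-injective; ↑ʳ-injective;
  splitAt-↑ˡ; splitAt-↑ʳ; join-splitAt; remQuot-combine; combine-remQuot; punchIn-punchOut; all?; any?; ¬∀⟶∃¬; pigeonhole)
open import Data.List as List using (List; length; filterᵇ)
open import Data.List.Membership.Propositional using (_∈_)
open import Data.List.Membership.Propositional.Properties using (∈-tabulate⁻)
open import Data.List.Properties using (length-tabulate)
open import Data.List.Relation.Unary.All using (All)
import Data.List.Relation.Unary.All.Properties as All
open import Data.List.Relation.Unary.Unique.Propositional using (Unique)
import Data.List.Relation.Unary.Unique.Propositional.Properties as Unique
open import Data.Maybe as Maybe using (Maybe; just; nothing; is-just)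
open import Data.Nat hiding (_≟_)
open import Data.Nat.DivMod using (_/_; m/n*n≤m; m≡m%n+[m/n]*n; m%n<n)
open import Data.Nat.Properties hiding (_≟_)
open import Data.Nat.Tactic.RingSolver using (solve-∀)
open import Data.Product as Product using (Σ; ∃; ∃₂; _×_; _,_; proj₁; proj₂)
open import Data.Sum as Sum using (_⊎_; inj₁; inj₂; [_,_]′)
open import Data.Vec using (Vec; []; _∷_; lookup; tabulate; replicate)
open import Data.Vec.Properties using (lookup∘tabulate)
open import Function using (_∘_; id)
open import Function.Definitions using (Injective)
open import Relation.Binary using (tri<; tri≈; tri>)
open import Relation.Binary.PropositionalEquality
open import Relation.Nullary using (¬_; Dec; yes; no; contradiction; ¬?; _×-dec_)
open import Relation.Nullary.Decidable using (⌊_⌋)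
open import Algebra.Properties.Semiring.Sum +-*-semiring
  using (sum; sum-cong-≗; sum-replicate-zero; ∑-distrib-+; ∑-comm; *-distribˡ-sum; *-distribʳ-sum)

-- Sums over vectors

-- Why the product of the two counts: with m minterms and M maxterms, a random minterm makes a given
-- vertex stuck with probability at least 1/m. Each stuck vertex gains a factor 2 once its κ
-- possible colours are paid for, while each vertex of B costs a factor 2κ. So B may have density
-- 1/m up to a polynomial in κ, and since every single maxterm must be seen often inside B, the
-- degree must exceed m M by such a polynomial.
--
-- Which vertices are stuck depends on the colouring of B, so the colours of stuck vertices are
-- enumerated only after those of B, whereas minterms and orientation are fixed before both.
--
-- All probability is counting: expectations are sums over vectors with the denominators multiplied
-- out, and concentration comes from averaging 2^(-count), which reduces it to `product-gap`.
--
-- A balanced binary tree only provides κ that are powers of two. One coarser top level of bounded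
-- fan-in q gives κ = q 2^j at the price of a constant factor.

product : ∀ {n} → (Fin n → ℕ) → ℕ
product {zero}  f = 1
product {suc n} f = f zero * product (f ∘ suc)

⟦_⟧ : Bool → ℕ
⟦ b ⟧ = if b then 1 else 0

♯ : ∀ {n} → (Fin n → Bool) → ℕ
♯ p = sum (⟦_⟧ ∘ p)

*-exchange : ∀ a b c d → a * b * (c * d) ≡ a * c * (b * d)
*-exchange = interchange *-commutativeSemigroup

*-swapʳ : ∀ a b c → a * b * c ≡ a * c * b
*-swapʳ = xy∙z≈xz∙y *-commutativeSemigroup

sum-mono-≤ : ∀ {n} {f g : Fin n → ℕ} → (∀ i → f i ≤ g i) → sum f ≤ sum g
sum-mono-≤ {zero}  _   = z≤n
sum-mono-≤ {suc n} f≤g = +-mono-≤ (f≤g zero) (sum-mono-≤ (f≤g ∘ suc))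

sum-const : ∀ n c → sum {n} (λ _ → c) ≡ n * c
sum-const zero    c = refl
sum-const (suc n) c = cong (c +_) (sum-const n c)

sum-≤-const : ∀ {n c} {f : Fin n → ℕ} → (∀ i → f i ≤ c) → sum f ≤ n * c
sum-≤-const {n} {c} f≤c = ≤-trans (sum-mono-≤ f≤c) (≤-reflexive (sum-const n c))

sum-<-const : ∀ {n c} {f : Fin n → ℕ} → (∀ i → f i ≤ c) → ∀ j → f j < c → sum f < n * c
sum-<-const f≤c zero    fj<c = +-mono-<-≤ fj<c (sum-≤-const (f≤c ∘ suc))
sum-<-const f≤c (suc j) fj<c = +-mono-≤-< (f≤c zero) (sum-<-const (f≤c ∘ suc) j fj<c)

term≤sum : ∀ {n} (f : Fin n → ℕ) i → f i ≤ sum f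
term≤sum f zero    = m≤m+n _ _
term≤sum f (suc i) = ≤-trans (term≤sum (f ∘ suc) i) (m≤n+m _ _)

product-mono-≤ : ∀ {n} {f g : Fin n → ℕ} → (∀ i → f i ≤ g i) → product f ≤ product g
product-mono-≤ {zero}  _   = ≤-refl
product-mono-≤ {suc n} f≤g = *-mono-≤ (f≤g zero) (product-mono-≤ (f≤g ∘ suc))

-- The factor `b ^ ♯ p` on the left replaces the exponent `n ∸ ♯ p` on the right, so no truncated
-- subtraction enters.
product-if : ∀ {n} (p : Fin n → Bool) a b →
  product (λ i → if p i then a else b) * b ^ ♯ p ≡ a ^ ♯ p * b ^ n
product-if {zero}  p a b = refl
product-if {suc n} p a b with p zero
... | true  = trans (*-exchange a _ b _) (trans (cong (a * b *_) (product-if (p ∘ suc) a b)) (*-exchange a b _ _))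
... | false = trans (*-assoc b _ _) (trans (cong (b *_) (product-if (p ∘ suc) a b)) (lemma b (a ^ ♯ (p ∘ suc)) (b ^ n)))
  where
  lemma : ∀ b x y → b * (x * y) ≡ x * (b * y)
  lemma = solve-∀

product-if-1 : ∀ {n} (p : Fin n → Bool) a → product (λ i → if p i then a else 1) ≡ a ^ ♯ p
product-if-1 {n} p a = begin
  P                 ≡⟨ *-identityʳ P ⟨
  P * 1             ≡⟨ cong (P *_) (^-zeroˡ (♯ p)) ⟨
  P * 1 ^ ♯ p       ≡⟨ product-if p a 1 ⟩
  a ^ ♯ p * 1 ^ n   ≡⟨ cong (a ^ ♯ p *_) (^-zeroˡ n) ⟩
  a ^ ♯ p * 1       ≡⟨ *-identityʳ _ ⟩
  a ^ ♯ p           ∎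
  where
  open ≡-Reasoning
  P = product (λ i → if p i then a else 1)

-- Encodes a count exponentially: the product is `2 ^ n` times 2^(-♯ p), so its average over a
-- random `p` controls the lower tail of `♯ p`.
product-half : ∀ {n} (p : Fin n → Bool) → product (λ i → if p i then 1 else 2) * 2 ^ ♯ p ≡ 2 ^ n
product-half {n} p = trans (product-if p 1 2) (trans (cong (_* 2 ^ n) (^-zeroˡ (♯ p))) (*-identityˡ _))

⟦⟧≤1 : ∀ b → ⟦ b ⟧ ≤ 1
⟦⟧≤1 true  = ≤-refl
⟦⟧≤1 false = z≤n

♯-mono : ∀ {n} {p q : Fin n → Bool} → (∀ i → p i ≡ true → q i ≡ true) → ♯ p ≤ ♯ q
♯-mono {n} {p} {q} p⇒q = sum-mono-≤ λ i → pointwise (p i) (q i) (p⇒q i)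
  where
  pointwise : ∀ a b → (a ≡ true → b ≡ true) → ⟦ a ⟧ ≤ ⟦ b ⟧
  pointwise false b _ = z≤n
  pointwise true  b h rewrite h refl = ≤-refl

sum-combine : ∀ m {n} (f : Fin (m * n) → ℕ) → sum f ≡ sum {m} (λ i → sum {n} (λ j → f (combine i j)))
sum-combine zero        f = refl
sum-combine (suc m) {n} f = trans (sum-++ n {m * n} f) (cong (sum (λ j → f (j ↑ˡ m * n)) +_) (sum-combine m (λ k → f (n ↑ʳ k))))
  where
  sum-++ : ∀ a {b} (f : Fin (a + b) → ℕ) → sum f ≡ sum (λ i → f (i ↑ˡ b)) + sum (λ j → f (a ↑ʳ j))
  sum-++ zero    f = refl
  sum-++ (suc a) f = trans (cong (f zero +_) (sum-++ a (f ∘ suc))) (sym (+-assoc (f zero) _ _))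

-- An expectation over a uniform random function from `Fin n` to `Fin x`, without the division by
-- `x ^ n`.
∑ᵛ : ∀ {x} n → (Vec (Fin x) n → ℕ) → ℕ
∑ᵛ zero    f = f []
∑ᵛ (suc n) f = sum λ a → ∑ᵛ n λ v → f (a ∷ v)

∑ᵛ-mono-≤ : ∀ {x} n {f g : Vec (Fin x) n → ℕ} → (∀ v → f v ≤ g v) → ∑ᵛ n f ≤ ∑ᵛ n g
∑ᵛ-mono-≤ zero    f≤g = f≤g []
∑ᵛ-mono-≤ (suc n) f≤g = sum-mono-≤ λ a → ∑ᵛ-mono-≤ n λ v → f≤g (a ∷ v)

∑ᵛ-cong : ∀ {x} n {f g : Vec (Fin x) n → ℕ} → (∀ v → f v ≡ g v) → ∑ᵛ n f ≡ ∑ᵛ n g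
∑ᵛ-cong zero    f≡g = f≡g []
∑ᵛ-cong (suc n) f≡g = sum-cong-≗ λ a → ∑ᵛ-cong n λ v → f≡g (a ∷ v)

∑ᵛ-*ˡ : ∀ {x} n c (f : Vec (Fin x) n → ℕ) → c * ∑ᵛ n f ≡ ∑ᵛ n (λ v → c * f v)
∑ᵛ-*ˡ zero    c f = refl
∑ᵛ-*ˡ {x} (suc n) c f = trans (*-distribˡ-sum c λ a → ∑ᵛ n λ v → f (a ∷ v)) (sum-cong-≗ {x} λ a → ∑ᵛ-*ˡ n c λ v → f (a ∷ v))

∑ᵛ-*ʳ : ∀ {x} n c (f : Vec (Fin x) n → ℕ) → ∑ᵛ n f * c ≡ ∑ᵛ n (λ v → f v * c)
∑ᵛ-*ʳ n c f = trans (*-comm _ c) (trans (∑ᵛ-*ˡ n c f) (∑ᵛ-cong n λ v → *-comm c (f v)))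

∑ᵛ-+ : ∀ {x} n (f g : Vec (Fin x) n → ℕ) → ∑ᵛ n (λ v → f v + g v) ≡ ∑ᵛ n f + ∑ᵛ n g
∑ᵛ-+ zero    f g = refl
∑ᵛ-+ {x} (suc n) f g = trans (sum-cong-≗ {x} λ a → ∑ᵛ-+ n (λ v → f (a ∷ v)) (λ v → g (a ∷ v)))
  (∑-distrib-+ (λ a → ∑ᵛ n λ v → f (a ∷ v)) _)

∑ᵛ-sum : ∀ {x y} n (f : Vec (Fin x) n → Fin y → ℕ) →
  ∑ᵛ n (λ v → sum (f v)) ≡ sum (λ j → ∑ᵛ n (λ v → f v j))
∑ᵛ-sum zero    f = refl
∑ᵛ-sum {x} (suc n) f = trans (sum-cong-≗ {x} λ a → ∑ᵛ-sum n λ v → f (a ∷ v)) (∑-comm λ a j → ∑ᵛ n λ v → f (a ∷ v) j)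

∑ᵛ-comm : ∀ {x y} n k (f : Vec (Fin x) n → Vec (Fin y) k → ℕ) →
  ∑ᵛ n (λ v → ∑ᵛ k (f v)) ≡ ∑ᵛ k (λ w → ∑ᵛ n (λ v → f v w))
∑ᵛ-comm n zero    f = refl
∑ᵛ-comm {y = y} n (suc k) f = trans (∑ᵛ-sum n λ v b → ∑ᵛ k λ w → f v (b ∷ w)) (sum-cong-≗ {y} λ b → ∑ᵛ-comm n k λ v w → f v (b ∷ w))

-- Independence of the coordinates, as the distributive law.
∑ᵛ-product : ∀ {x} n (f : Fin n → Fin x → ℕ) →
  ∑ᵛ n (λ v → product (λ i → f i (lookup v i))) ≡ product (λ i → sum (f i))
∑ᵛ-product zero    f = refl
∑ᵛ-product {x} (suc n) f = begin
  sum (λ a → ∑ᵛ n λ v → f zero a * P v)  ≡⟨ sum-cong-≗ {x} (λ a → sym (∑ᵛ-*ˡ n (f zero a) P)) ⟩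
  sum (λ a → f zero a * ∑ᵛ n P)          ≡⟨ *-distribʳ-sum (∑ᵛ n P) (f zero) ⟨
  sum (f zero) * ∑ᵛ n P                  ≡⟨ cong (sum (f zero) *_) (∑ᵛ-product n (f ∘ suc)) ⟩
  sum (f zero) * product (λ i → sum (f (suc i))) ∎
  where
  open ≡-Reasoning
  P = λ v → product (λ i → f (suc i) (lookup v i))

∑ᵛ-const : ∀ x n c → ∑ᵛ {x} n (λ _ → c) ≡ x ^ n * c
∑ᵛ-const x zero    c = sym (*-identityˡ c)
∑ᵛ-const x (suc n) c = trans (sum-cong-≗ {x} λ _ → ∑ᵛ-const x n c) (trans (sum-const x _) (sym (*-assoc x _ c)))

∑ᵛ-lookup : ∀ {x} n (h : Fin x → ℕ) i → x * ∑ᵛ n (λ v → h (lookup v i)) ≡ x ^ n * sum h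
∑ᵛ-lookup {x} (suc n) h zero = begin
  x * sum (λ a → ∑ᵛ n λ _ → h a)  ≡⟨ cong (x *_) (sum-cong-≗ {x} λ a → ∑ᵛ-const x n (h a)) ⟩
  x * sum (λ a → x ^ n * h a)     ≡⟨ cong (x *_) (*-distribˡ-sum (x ^ n) h) ⟨
  x * (x ^ n * sum h)             ≡⟨ *-assoc x _ _ ⟨
  x * x ^ n * sum h               ∎
  where open ≡-Reasoning
∑ᵛ-lookup {x} (suc n) h (suc i) = begin
  x * sum {x} (λ a → ∑ᵛ n λ v → h (lookup v i))  ≡⟨ cong (x *_) (sum-const x _) ⟩
  x * (x * ∑ᵛ n λ v → h (lookup v i))        ≡⟨ cong (x *_) (∑ᵛ-lookup n h i) ⟩
  x * (x ^ n * sum h)                        ≡⟨ *-assoc x _ _ ⟨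
  x * x ^ n * sum h                          ∎
  where open ≡-Reasoning

term≤∑ᵛ : ∀ {x} n (f : Vec (Fin x) n → ℕ) v → f v ≤ ∑ᵛ n f
term≤∑ᵛ zero    f []      = ≤-refl
term≤∑ᵛ (suc n) f (a ∷ v) = ≤-trans (term≤∑ᵛ n (λ v → f (a ∷ v)) v) (term≤sum (λ a → ∑ᵛ n λ v → f (a ∷ v)) a)

sum-below-average : ∀ {n} (f : Fin n → ℕ) c → sum f < n * c → ∃ λ i → f i < c
sum-below-average {suc n} f c Σf<nc with f zero <? c
... | yes f0<c = zero , f0<c
... | no  f0≮c = let i , fi<c = sum-below-average (f ∘ suc) c
                       (≰⇒> λ nc≤Σf → <⇒≱ Σf<nc (+-mono-≤ (≮⇒≥ f0≮c) nc≤Σf))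
                 in suc i , fi<c

-- The first moment method; the coordinates are fixed one at a time, keeping the conditional average
-- below `c`.
∑ᵛ-below-average : ∀ {x} n (f : Vec (Fin x) n → ℕ) c → ∑ᵛ n f < x ^ n * c → ∃ λ v → f v < c
∑ᵛ-below-average zero    f c f<c = [] , subst (f [] <_) (*-identityˡ c) f<c
∑ᵛ-below-average {x} (suc n) f c Σf<c =
  let a , Σfa<c = sum-below-average (λ a → ∑ᵛ n λ v → f (a ∷ v)) (x ^ n * c) (subst (∑ᵛ (suc n) f <_) (*-assoc x (x ^ n) c) Σf<c)
      v , fav<c = ∑ᵛ-below-average n (λ v → f (a ∷ v)) c Σfa<c
  in a ∷ v , fav<c

-- Pinning v to zero off S makes vectors supported in S encode functions on S.
supportedIn : ∀ {n k} → (Fin n → Bool) → Vec (Fin (suc k)) n → Fin n → Bool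
supportedIn S v i = S i ∨ ⌊ lookup v i ≟ zero ⌋

∑ᵛ-supported : ∀ {n} k (S : Fin n → Bool) →
  ∑ᵛ {suc k} n (λ v → product (λ i → ⟦ supportedIn S v i ⟧)) ≡ suc k ^ ♯ S
∑ᵛ-supported {n} k S = begin
  ∑ᵛ n (λ v → product (λ i → ⟦ supportedIn S v i ⟧))      ≡⟨ ∑ᵛ-product {suc k} n (λ i a → ⟦ S i ∨ ⌊ a ≟ zero ⌋ ⟧) ⟩
  product (λ i → sum {suc k} (λ a → ⟦ S i ∨ ⌊ a ≟ zero ⌋ ⟧))      ≡⟨ product-cong {n} (λ i → column (S i)) ⟩
  product (λ i → if S i then suc k else 1)                ≡⟨ product-if-1 S (suc k) ⟩
  suc k ^ ♯ S                                             ∎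
  where
  open ≡-Reasoning
  product-cong : ∀ {n} {f g : Fin n → ℕ} → (∀ i → f i ≡ g i) → product f ≡ product g
  product-cong {zero}  _   = refl
  product-cong {suc n} f≡g = cong₂ _*_ (f≡g zero) (product-cong (f≡g ∘ suc))
  column : ∀ b → sum {suc k} (λ a → ⟦ b ∨ ⌊ a ≟ zero ⌋ ⟧) ≡ (if b then suc k else 1)
  column true  = trans (sum-const (suc k) 1) (*-identityʳ (suc k))
  column false = cong suc (sum-replicate-zero k)

-- Acyclic orientations

-- This is (1 + 1/a)^k ≥ 1 + k/a multiplied by a^(k+1).
bernoulli : ∀ a k → a ^ k * (a + k) ≤ a * suc a ^ k
bernoulli a zero    = ≤-reflexive (lemma a)
  where
  lemma : ∀ a → 1 * (a + 0) ≡ a * 1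
  lemma = solve-∀
bernoulli a (suc k) = begin
  a * a ^ k * (a + suc k)                ≤⟨ m≤m+n _ (a ^ k * k) ⟩
  a * a ^ k * (a + suc k) + a ^ k * k    ≡⟨ lemma₁ a k (a ^ k) ⟩
  suc a * (a ^ k * (a + k))              ≤⟨ *-monoʳ-≤ (suc a) (bernoulli a k) ⟩
  suc a * (a * suc a ^ k)                ≡⟨ lemma₂ a (suc a ^ k) ⟩
  a * suc a ^ suc k                      ∎
  where
  open ≤-Reasoning
  lemma₁ : ∀ a k x → a * x * (a + suc k) + x * k ≡ suc a * (x * (a + k))
  lemma₁ = solve-∀
  lemma₂ : ∀ a y → suc a * (a * y) ≡ a * (suc a * y)
  lemma₂ = solve-∀

2*a^[1+a]≤[1+a]^[1+a] : ∀ a → a ^ suc a * 2 ≤ suc a ^ suc a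
2*a^[1+a]≤[1+a]^[1+a] zero      = z≤n
2*a^[1+a]≤[1+a]^[1+a] a@(suc _) = *-cancelˡ-≤ a (begin
  a * (a ^ b * 2)             ≤⟨ m≤m+n _ (a ^ b) ⟩
  a * (a ^ b * 2) + a ^ b     ≡⟨ lemma a (a ^ b) ⟩
  a ^ b * (a + b)             ≤⟨ bernoulli a b ⟩
  a * b ^ b                   ∎)
  where
  open ≤-Reasoning
  b = suc a
  lemma : ∀ a x → a * (x * 2) + x ≡ x * (a + suc a)
  lemma = solve-∀

^-distribʳ-* : ∀ a b n → (a * b) ^ n ≡ a ^ n * b ^ n
^-distribʳ-* a b zero    = refl
^-distribʳ-* a b (suc n) = trans (cong (a * b *_) (^-distribʳ-* a b n)) (*-exchange a b (a ^ n) (b ^ n))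

power-gap : ∀ a s k → suc a * s ≤ k → a ^ k * 2 ^ s ≤ suc a ^ k
power-gap a s k bs≤k with m≤n⇒∃[o]m+o≡n bs≤k
... | e , refl = begin
  a ^ (b * s + e) * 2 ^ s            ≡⟨ cong (_* 2 ^ s) (^-distribˡ-+-* a (b * s) e) ⟩
  a ^ (b * s) * a ^ e * 2 ^ s        ≡⟨ cong (λ x → x * a ^ e * 2 ^ s) (^-*-assoc a b s) ⟨
  (a ^ b) ^ s * a ^ e * 2 ^ s        ≡⟨ *-swapʳ ((a ^ b) ^ s) (a ^ e) (2 ^ s) ⟩
  (a ^ b) ^ s * 2 ^ s * a ^ e        ≡⟨ cong (_* a ^ e) (^-distribʳ-* (a ^ b) 2 s) ⟨
  (a ^ b * 2) ^ s * a ^ e            ≤⟨ *-mono-≤ (^-monoˡ-≤ s (2*a^[1+a]≤[1+a]^[1+a] a)) (^-monoˡ-≤ e (n≤1+n a)) ⟩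
  (b ^ b) ^ s * b ^ e                ≡⟨ cong (_* b ^ e) (^-*-assoc b b s) ⟩
  b ^ (b * s) * b ^ e                ≡⟨ ^-distribˡ-+-* b (b * s) e ⟨
  b ^ (b * s + e)                    ∎
  where
  open ≤-Reasoning
  b = suc a

-- The concentration inequality of the proof. A coordinate in `p` has average weight at most 1 -
-- 1/(1+a), and every 1+a such coordinates halve the product. It serves both for the sampling of B
-- and for the random minterms.
product-gap : ∀ {n} a s (p : Fin n → Bool) (w : Fin n → ℕ) →
  (∀ i → w i ≤ (if p i then a else suc a)) → suc a * s ≤ ♯ p → product w * 2 ^ s ≤ suc a ^ n
product-gap {n} a s p w w≤ bs≤♯p = *-cancelʳ-≤ _ _ (b ^ ♯ p) ⦃ m^n≢0 b (♯ p) ⦄ (begin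
  product w * 2 ^ s * b ^ ♯ p    ≤⟨ *-monoˡ-≤ (b ^ ♯ p) (*-monoˡ-≤ (2 ^ s) (product-mono-≤ w≤)) ⟩
  P * 2 ^ s * b ^ ♯ p            ≡⟨ *-swapʳ P (2 ^ s) (b ^ ♯ p) ⟩
  P * b ^ ♯ p * 2 ^ s            ≡⟨ cong (_* 2 ^ s) (product-if p a b) ⟩
  a ^ ♯ p * b ^ n * 2 ^ s        ≡⟨ *-swapʳ (a ^ ♯ p) (b ^ n) (2 ^ s) ⟩
  a ^ ♯ p * 2 ^ s * b ^ n        ≤⟨ *-monoˡ-≤ (b ^ n) (power-gap a s (♯ p) bs≤♯p) ⟩
  b ^ ♯ p * b ^ n                ≡⟨ *-comm (b ^ ♯ p) (b ^ n) ⟩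
  b ^ n * b ^ ♯ p                ∎)
  where
  open ≤-Reasoning
  b = suc a
  P = product (λ i → if p i then a else b)

-- Counting orientations by deletion and contraction.

PointsAlong : Fin 2 → ℕ → ℕ → Set
PointsAlong zero    x y = x < y
PointsAlong (suc _) x y = y < x

-- Slots holding `nothing` let the orientation vector keep one length while the graph under it
-- varies with the colouring.
Edges : ℕ → ℕ → Set
Edges e v = Fin e → Maybe (Fin v × Fin v)

IsPotential : ∀ {e v} → Edges e v → Vec (Fin 2) e → (Fin v → ℕ) → Set
IsPotential edges o π = ∀ i {x y} → edges i ≡ just (x , y) → PointsAlong (lookup o i) (π x) (π y)

PointsAlong-combination : ∀ b c d {x y x′ y′} → PointsAlong b x y → PointsAlong b x′ y′ →
  PointsAlong b (suc c * x + suc d * x′) (suc c * y + suc d * y′)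
PointsAlong-combination zero    c d p q = +-mono-< (*-monoʳ-< (suc c) p) (*-monoʳ-< (suc d) q)
PointsAlong-combination (suc _) c d p q = +-mono-< (*-monoʳ-< (suc c) p) (*-monoʳ-< (suc d) q)

-- The vertex map of a contraction: `x` leaves the numbering and takes over the new name of `y`.
identify : ∀ {v} {x y : Fin (suc v)} → x ≢ y → Fin (suc v) → Fin v
identify {x = x} x≢y z with x ≟ z
... | yes _   = punchOut x≢y
... | no  x≢z = punchOut x≢z

identify-potential : ∀ {v} {x y : Fin (suc v)} (x≢y : x ≢ y) (π : Fin (suc v) → ℕ) → π x ≡ π y →
  ∀ z → π (punchIn x (identify x≢y z)) ≡ π z
identify-potential {x = x} x≢y π πx≡πy z with x ≟ z
... | yes refl = trans (cong π (punchIn-punchOut x≢y)) (sym πx≡πy)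
... | no  x≢z  = cong π (punchIn-punchOut x≢z)

contract : ∀ {e v} {x y : Fin (suc v)} → x ≢ y → Edges e (suc v) → Edges e v
contract x≢y edges i = Maybe.map (Product.map (identify x≢y) (identify x≢y)) (edges i)

-- If both directions of an edge xy extend an orientation acyclically, a positive combination of the
-- two potentials agrees at x and y, so the orientation stays acyclic after contracting xy.
contract-potential : ∀ {e v} {x y : Fin (suc v)} (x≢y : x ≢ y) (edges : Edges e (suc v)) o {π ρ} →
  IsPotential edges o π → π x < π y → IsPotential edges o ρ → ρ y < ρ x →
  Σ (Fin v → ℕ) (IsPotential (contract x≢y edges) o)
contract-potential {x = x} {y} x≢y edges o {π} {ρ} isπ πx<πy isρ ρy<ρx
  with m≤n⇒∃[o]m+o≡n πx<πy | m≤n⇒∃[o]m+o≡n ρy<ρx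
... | c , πy≡ | d , ρx≡ = σ ∘ punchIn x , isσ
  where
  σ : _ → ℕ
  σ z = suc d * π z + suc c * ρ z
  lemma : ∀ c d p r → suc d * p + suc c * (suc r + d) ≡ suc d * (suc p + c) + suc c * r
  lemma = solve-∀
  σx≡σy : σ x ≡ σ y
  σx≡σy = begin
    suc d * π x + suc c * ρ x              ≡⟨ cong (λ z → suc d * π x + suc c * z) ρx≡ ⟨
    suc d * π x + suc c * (suc (ρ y) + d)  ≡⟨ lemma c d (π x) (ρ y) ⟩
    suc d * (suc (π x) + c) + suc c * ρ y  ≡⟨ cong (λ z → suc d * z + suc c * ρ y) πy≡ ⟩
    suc d * π y + suc c * ρ y              ∎
    where open ≡-Reasoning
  isσ : IsPotential (contract x≢y edges) o (σ ∘ punchIn x)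
  isσ i eq with edges i in eqᵢ
  isσ i refl | just (a , b) = subst₂ (PointsAlong (lookup o i))
    (sym (identify-potential x≢y σ σx≡σy a)) (sym (identify-potential x≢y σ σx≡σy b))
    (PointsAlong-combination (lookup o i) d c (isπ i eqᵢ) (isρ i eqᵢ))

satisfying : ∀ {e} → (Vec (Fin 2) e → Bool) → ℕ
satisfying {e} P = ∑ᵛ e (⟦_⟧ ∘ P)

-- The bound f(r, v) = 2^v (3/2)^r satisfies f(r, v+1) + f(r, v) = f(r+1, v+1), which is
-- deletion-contraction; relative to all 2^e orientations the 3/2 becomes 3/4. An arbitrary `P`
-- implying a potential keeps the induction closed under `either` and `both`.
acyclic-orientations : ∀ e v (edges : Edges e v) (P : Vec (Fin 2) e → Bool) →
  (∀ o → P o ≡ true → ∃ (IsPotential edges o)) →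
  let r = ♯ (is-just ∘ edges) in satisfying P * 4 ^ r ≤ 2 ^ v * 3 ^ r * 2 ^ e
acyclic-orientations zero v edges P acyclic = begin
  ⟦ P [] ⟧ * 1   ≤⟨ *-monoˡ-≤ 1 (⟦⟧≤1 (P [])) ⟩
  1              ≤⟨ m^n>0 2 v ⟩
  2 ^ v          ≡⟨ lemma (2 ^ v) ⟩
  2 ^ v * 1 * 1  ∎
  where
  open ≤-Reasoning
  lemma : ∀ x → x ≡ x * 1 * 1
  lemma = solve-∀
acyclic-orientations (suc e) v edges P acyclic with edges zero in eq₀
... | nothing = begin
  (satisfying (P ∘ (0F ∷_)) + (satisfying (P ∘ (1F ∷_)) + 0)) * 4 ^ r             ≡⟨ lemma₁ (satisfying (P ∘ (0F ∷_))) (satisfying (P ∘ (1F ∷_))) (4 ^ r) ⟩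
  satisfying (P ∘ (0F ∷_)) * 4 ^ r + satisfying (P ∘ (1F ∷_)) * 4 ^ r             ≤⟨ +-mono-≤ (below 0F) (below 1F) ⟩
  2 ^ v * 3 ^ r * 2 ^ e + 2 ^ v * 3 ^ r * 2 ^ e                 ≡⟨ lemma₂ (2 ^ v) (3 ^ r) (2 ^ e) ⟩
  2 ^ v * 3 ^ r * 2 ^ suc e                                     ∎
  where
  open ≤-Reasoning
  r = ♯ (is-just ∘ edges ∘ suc)
  lemma₁ : ∀ p q x → (p + (q + 0)) * x ≡ p * x + q * x
  lemma₁ = solve-∀
  lemma₂ : ∀ x y z → x * y * z + x * y * z ≡ x * y * (2 * z)
  lemma₂ = solve-∀
  below : ∀ b → satisfying (P ∘ (b ∷_)) * 4 ^ r ≤ 2 ^ v * 3 ^ r * 2 ^ e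
  below b = acyclic-orientations e v (edges ∘ suc) (P ∘ (b ∷_)) λ o Po →
    let π , isπ = acyclic (b ∷ o) Po in π , isπ ∘ suc
acyclic-orientations (suc e) (suc v) edges P acyclic | just (x , y) with x ≟ y
... | yes refl = begin
  (satisfying (P ∘ (0F ∷_)) + (satisfying (P ∘ (1F ∷_)) + 0)) * 4 ^ suc r         ≡⟨ cong₂ (λ p q → (p + (q + 0)) * 4 ^ suc r) (none 0F) (none 1F) ⟩
  0                                                             ≤⟨ z≤n ⟩
  2 ^ suc v * 3 ^ suc r * 2 ^ suc e                             ∎
  where
  open ≤-Reasoning
  r = ♯ (is-just ∘ edges ∘ suc)
  irreflexive : ∀ b {n} → ¬ PointsAlong b n n
  irreflexive zero    = <-irrefl refl
  irreflexive (suc _) = <-irrefl refl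
  false′ : ∀ b o → ⟦ P (b ∷ o) ⟧ ≡ 0
  false′ b o with P (b ∷ o) in Po
  ... | false = refl
  ... | true  = contradiction (proj₂ (acyclic (b ∷ o) Po) zero eq₀) (irreflexive b)
  none : ∀ b → satisfying (P ∘ (b ∷_)) ≡ 0
  none b = trans (∑ᵛ-cong e (false′ b)) (trans (∑ᵛ-const 2 e 0) (*-zeroʳ (2 ^ e)))
... | no x≢y = begin
  (satisfying (P ∘ (0F ∷_)) + (satisfying (P ∘ (1F ∷_)) + 0)) * 4 ^ suc r         ≡⟨ cong (_* 4 ^ suc r) split ⟩
  (satisfying either + satisfying both) * 4 ^ suc r                               ≡⟨ lemma₁ (satisfying either) (satisfying both) (4 ^ r) ⟩
  4 * (satisfying either * 4 ^ r + satisfying both * 4 ^ r)                       ≤⟨ *-monoʳ-≤ 4 (+-mono-≤ either-few both-few) ⟩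
  4 * (2 ^ suc v * 3 ^ r * 2 ^ e + 2 ^ v * 3 ^ r * 2 ^ e)       ≡⟨ lemma₂ (2 ^ v) (3 ^ r) (2 ^ e) ⟩
  2 ^ suc v * 3 ^ suc r * 2 ^ suc e                             ∎
  where
  open ≤-Reasoning
  r = ♯ (is-just ∘ edges ∘ suc)
  either both : Vec (Fin 2) e → Bool
  -- Two sets have total size |union| + |intersection|. The union is bounded after deleting the
  -- edge, the intersection after contracting it.
  either o = P (0F ∷ o) ∨ P (1F ∷ o)
  both   o = P (0F ∷ o) ∧ P (1F ∷ o)
  lemma₁ : ∀ p q x → (p + q) * (4 * x) ≡ 4 * (p * x + q * x)
  lemma₁ = solve-∀
  lemma₂ : ∀ x y z → 4 * (2 * x * y * z + x * y * z) ≡ 2 * x * (3 * y) * (2 * z)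
  lemma₂ = solve-∀
  ∨∧ : ∀ p q → ⟦ p ⟧ + ⟦ q ⟧ ≡ ⟦ p ∨ q ⟧ + ⟦ p ∧ q ⟧
  ∨∧ true  true  = refl
  ∨∧ true  false = refl
  ∨∧ false true  = refl
  ∨∧ false false = refl
  split : satisfying (P ∘ (0F ∷_)) + (satisfying (P ∘ (1F ∷_)) + 0) ≡ satisfying either + satisfying both
  split = trans (cong (satisfying (P ∘ (0F ∷_)) +_) (+-identityʳ _)) (trans (sym (∑ᵛ-+ e _ _))
    (trans (∑ᵛ-cong e λ o → ∨∧ (P (0F ∷ o)) (P (1F ∷ o))) (∑ᵛ-+ e _ _)))
  either-few : satisfying either * 4 ^ r ≤ 2 ^ suc v * 3 ^ r * 2 ^ e
  either-few = acyclic-orientations e (suc v) (edges ∘ suc) either potential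
    where
    potential : ∀ o → either o ≡ true → ∃ (IsPotential (edges ∘ suc) o)
    potential o Po with P (0F ∷ o) in P₀
    ... | true  = let π , isπ = acyclic (0F ∷ o) P₀ in π , isπ ∘ suc
    ... | false = let π , isπ = acyclic (1F ∷ o) Po in π , isπ ∘ suc
  is-just-contract : ∀ i → ⟦ is-just (contract x≢y (edges ∘ suc) i) ⟧ ≡ ⟦ is-just (edges (suc i)) ⟧
  is-just-contract i with edges (suc i)
  ... | just _  = refl
  ... | nothing = refl
  both-few : satisfying both * 4 ^ r ≤ 2 ^ v * 3 ^ r * 2 ^ e
  both-few = subst (λ r → satisfying both * 4 ^ r ≤ 2 ^ v * 3 ^ r * 2 ^ e) (sum-cong-≗ is-just-contract)
    (acyclic-orientations e v (contract x≢y (edges ∘ suc)) both potential)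
    where
    potential : ∀ o → both o ≡ true → ∃ (IsPotential (contract x≢y (edges ∘ suc)) o)
    potential o Po with P (0F ∷ o) in P₀ | P (1F ∷ o) in P₁
    ... | true  | true  =
      let π , isπ = acyclic (0F ∷ o) P₀
          ρ , isρ = acyclic (1F ∷ o) P₁
      in contract-potential x≢y (edges ∘ suc) o (isπ ∘ suc) (isπ zero eq₀) (isρ ∘ suc) (isρ zero eq₀)
    potential o () | true  | false
    potential o () | false | _

-- Potentials and cycles

Cycle : ∀ {n} → (Fin n → Fin n → Bool) → Set
Cycle {n} R = Σ ℕ λ l → Σ (Fin (suc l) → Fin n) λ c →
  Injective _≡_ _≡_ c × (∀ i → R (c (inject₁ i)) (c (suc i)) ≡ true) × R (c (fromℕ l)) (c zero) ≡ true

-- A repeated vertex cuts out a shorter closed walk. The walk is indexed by all of ℕ, so passing to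
-- a segment is a mere shift.
closed-walk⇒cycle : ∀ {n} (R : Fin n → Fin n → Bool) fuel l (x : ℕ → Fin n) → l < fuel →
  (∀ i → R (x i) (x (suc i)) ≡ true) → x (suc l) ≡ x 0 → Cycle R
closed-walk⇒cycle R (suc fuel) l x (s≤s l≤fuel) walk closed
  with any? (λ (s : Fin (suc l)) → any? λ (t : Fin (suc l)) → (toℕ s <? toℕ t) ×-dec (x (toℕ s) ≟ x (toℕ t)))
... | yes (s , t , s<t , xs≡xt) with m≤n⇒∃[o]m+o≡n s<t
...   | d , s+d≡t = closed-walk⇒cycle R fuel d (λ i → x (i + toℕ s)) d<fuel (λ i → walk (i + toℕ s))
        (trans (cong x (trans (cong suc (+-comm d (toℕ s))) s+d≡t)) (sym xs≡xt))
  where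
  d<fuel : d < fuel
  d<fuel = ≤-trans (s≤s (m≤n+m d (toℕ s))) (≤-trans (≤-reflexive s+d≡t) (≤-trans (s≤s⁻¹ (toℕ<n t)) l≤fuel))
closed-walk⇒cycle R (suc fuel) l x _ walk closed | no distinct = l , x ∘ toℕ , injective , arcs , closing
  where
  injective : Injective _≡_ _≡_ (x ∘ toℕ)
  injective {s} {t} xs≡xt with <-cmp (toℕ s) (toℕ t)
  ... | tri< s<t _ _ = contradiction (s , t , s<t , xs≡xt) distinct
  ... | tri≈ _ s≡t _ = toℕ-injective s≡t
  ... | tri> _ _ t<s = contradiction (t , s , t<s , sym xs≡xt) distinct
  arcs : ∀ (i : Fin l) → R (x (toℕ (inject₁ i))) (x (suc (toℕ i))) ≡ true
  arcs i = subst (λ k → R (x k) (x (suc (toℕ i))) ≡ true) (sym (toℕ-inject₁ i)) (walk (toℕ i))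
  closing : R (x (toℕ (fromℕ l))) (x 0) ≡ true
  closing = subst₂ (λ a b → R a b ≡ true) (cong x (sym (toℕ-fromℕ l))) closed (walk l)

successors⇒cycle : ∀ {n} (R : Fin n → Fin n → Bool) (S : Fin n → Bool) →
  (∀ u → S u ≡ true → ∃ λ v → S v ≡ true × R u v ≡ true) → ∀ u → S u ≡ true → Cycle R
successors⇒cycle {n} R S succ u₀ Su₀ = revisit (pigeonhole (n<1+n n) (visit ∘ toℕ))
  where
  walk : ℕ → ∃ λ u → S u ≡ true
  walk zero    = u₀ , Su₀
  walk (suc i) = let v , Sv , _ = succ (proj₁ (walk i)) (proj₂ (walk i)) in v , Sv
  visit : ℕ → Fin n
  visit = proj₁ ∘ walk
  revisit : (∃₂ λ (i j : Fin (suc n)) → toℕ i < toℕ j × visit (toℕ i) ≡ visit (toℕ j)) → Cycle R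
  revisit (i , j , i<j , xi≡xj) = let l , i+l≡j = m≤n⇒∃[o]m+o≡n i<j in
    closed-walk⇒cycle R (suc l) l (λ k → visit (k + toℕ i)) ≤-refl
      (λ k → proj₂ (proj₂ (succ (visit (k + toℕ i)) (proj₂ (walk (k + toℕ i))))))
      (trans (cong visit (trans (cong suc (+-comm l (toℕ i))) i+l≡j)) (sym xi≡xj))

∧-true : ∀ {a b} → a ∧ b ≡ true → a ≡ true × b ≡ true
∧-true {true} {true} refl = refl , refl

true-∧ : ∀ {a b} → a ≡ true → b ≡ true → a ∧ b ≡ true
true-∧ refl refl = refl

Decreases : ∀ {n} → (Fin n → Fin n → Bool) → (Fin n → ℕ) → Set
Decreases R π = ∀ u v → R u v ≡ true → π v < π u

-- Sinks are peeled off one by one; when no sink is left among the remaining vertices, following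
-- successors must close up.
potential-or-cycle : ∀ {n} (R : Fin n → Fin n → Bool) → ∃ (Decreases R) ⊎ Cycle R
potential-or-cycle {n} R =
  Sum.map₁ (λ (π , dec) → π , λ u v → dec u v refl refl)
  (peel n (λ _ → true) (≤-reflexive (trans (sum-const n 1) (*-identityʳ n))))
  where
  peel : ∀ k (S : Fin n → Bool) → ♯ S ≤ k →
    (Σ (Fin n → ℕ) λ π → ∀ u v → S u ≡ true → S v ≡ true → R u v ≡ true → π v < π u) ⊎ Cycle R
  peel zero S ♯S≤0 = inj₁ ((λ _ → 0) , λ u _ Su → contradiction
    (≤-trans (subst (λ b → 1 ≤ ⟦ b ⟧) (sym Su) ≤-refl) (≤-trans (term≤sum (⟦_⟧ ∘ S) u) ♯S≤0)) λ ())
  peel (suc k) S ♯S≤1+k with any? (λ u → (S u ≟ᵇ true) ×-dec ¬? (any? λ v → (S v ∧ R u v) ≟ᵇ true))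
  ... | yes (u , Su , sink) with peel k (λ v → S v ∧ not ⌊ v ≟ u ⌋) (s≤s⁻¹ (≤-trans (removed S u Su) ♯S≤1+k))
    where
    removed : ∀ {n} (S : Fin n → Bool) u → S u ≡ true → ♯ (λ v → S v ∧ not ⌊ v ≟ u ⌋) < ♯ S
    removed S zero    Su rewrite Su = s≤s (♯-mono {q = S ∘ suc} λ i → proj₁ ∘ ∧-true)
    removed S (suc u) Su = +-mono-≤-< (∧-≤ (S zero)) (≤-trans (s≤s (♯-mono strip)) (removed (S ∘ suc) u Su))
      where
      ∧-≤ : ∀ a {b} → ⟦ a ∧ b ⟧ ≤ ⟦ a ⟧
      ∧-≤ false = z≤n
      ∧-≤ true {true}  = ≤-refl
      ∧-≤ true {false} = z≤n
      strip : ∀ i → S (suc i) ∧ not ⌊ suc i ≟ suc u ⌋ ≡ true → S (suc i) ∧ not ⌊ i ≟ u ⌋ ≡ true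
      strip i h with i ≟ u
      ... | yes _ = h
      ... | no  _ = h
  ...   | inj₂ cycle = inj₂ cycle
  ...   | inj₁ (π , dec) = inj₁ (π′ , dec′)
    where
    π′ : Fin n → ℕ
    -- The peeled sink takes the bottom value and all others move up by one.
    π′ v with v ≟ u
    ... | yes _ = 0
    ... | no  _ = suc (π v)
    keep : ∀ {v} → v ≢ u → S v ≡ true → S v ∧ not ⌊ v ≟ u ⌋ ≡ true
    keep {v} v≢u Sv rewrite Sv with v ≟ u
    ... | yes v≡u = contradiction v≡u v≢u
    ... | no  _   = refl
    dec′ : ∀ a b → S a ≡ true → S b ≡ true → R a b ≡ true → π′ b < π′ a
    dec′ a b Sa Sb Rab with a ≟ u | b ≟ u
    ... | yes refl | _     = contradiction (b , true-∧ Sb Rab) sink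
    ... | no  _  | yes _   = s≤s z≤n
    ... | no a≢u | no b≢u  = s≤s (dec a b (keep a≢u Sa) (keep b≢u Sb) Rab)
  peel (suc k) S ♯S≤1+k | no nosink with any? (λ u → S u ≟ᵇ true)
  ...   | no  empty   = inj₁ ((λ _ → 0) , λ u _ Su → contradiction (u , Su) empty)
  ...   | yes (u , Su) = inj₂ (successors⇒cycle R S next u Su)
    where
    next : ∀ u → S u ≡ true → ∃ λ v → S v ≡ true × R u v ≡ true
    next u Su with any? (λ v → (S v ∧ R u v) ≟ᵇ true)
    ... | yes (v , h) = v , ∧-true h
    ... | no  none    = contradiction (u , Su , none) nosink

-- Gadgets: minterms and maxterms of monotone functions

-- A monotone Boolean function with m minterms of size a and M maxterms of size b.
record Gadget (a b m M : ℕ) : Set where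
  field
    width   : ℕ
    minterm : Fin m → Fin a → Fin width
    maxterm : Fin M → Fin b → Fin width
    minterm-injective : ∀ i → Injective _≡_ _≡_ (minterm i)
    maxterm-injective : ∀ j → Injective _≡_ _≡_ (maxterm j)
    dichotomy : (U : Fin width → Bool) →
      (∃ λ i → ∀ x → U (minterm i x) ≡ true) ⊎ (∃ λ j → ∀ y → U (maxterm j y) ≡ false)
open Gadget

dual : ∀ {a b m M} → Gadget a b m M → Gadget b a M m
dual g = record
  { width             = width g
  ; minterm           = maxterm g
  ; maxterm           = minterm g
  ; minterm-injective = maxterm-injective g
  ; maxterm-injective = minterm-injective g
  ; dichotomy         = λ U → Sum.swap (Sum.map
      (Product.map₂ λ h x → not-flip (h x)) (Product.map₂ λ h y → not-flip (h y)) (dichotomy g (not ∘ U)))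
  }
  where
  not-flip : ∀ {b c} → not b ≡ c → b ≡ not c
  not-flip refl = sym (not-involutive _)

⊎-injective : ∀ {a a′ w w′} {f : Fin a → Fin w} {f′ : Fin a′ → Fin w′} →
  Injective _≡_ _≡_ f → Injective _≡_ _≡_ f′ →
  Injective _≡_ _≡_ (λ x → [ (λ y → f y ↑ˡ w′) , (λ y → w ↑ʳ f′ y) ]′ (splitAt a x))
⊎-injective {a} {a′} {w} {w′} {f} {f′} inj inj′ {x} {y} eq = trans (sym (join-splitAt a a′ x))
  (trans (cong (join a a′) (split-≡ (splitAt a x) (splitAt a y) eq)) (join-splitAt a a′ y))
  where
  F : Fin a ⊎ Fin a′ → Fin (w + w′)
  F = [ (λ y → f y ↑ˡ w′) , (λ y → w ↑ʳ f′ y) ]′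
  apart : ∀ i j → i ↑ˡ w′ ≢ w ↑ʳ j
  apart i j i≡j with trans (sym (splitAt-↑ˡ w i w′)) (trans (cong (splitAt w) i≡j) (splitAt-↑ʳ w w′ j))
  ... | ()
  split-≡ : ∀ s t → F s ≡ F t → s ≡ t
  split-≡ (inj₁ s) (inj₁ t) e = cong inj₁ (inj (↑ˡ-injective w′ _ _ e))
  split-≡ (inj₁ s) (inj₂ t) e = contradiction e (apart _ _)
  split-≡ (inj₂ s) (inj₁ t) e = contradiction (sym e) (apart _ _)
  split-≡ (inj₂ s) (inj₂ t) e = cong inj₂ (inj′ (↑ʳ-injective w _ _ e))

-- The AND of two functions on disjoint variables: minterms are paired, while falsifying either side
-- suffices for a maxterm.
_⊗_ : ∀ {a a′ b m m′ M M′} → Gadget a b m M → Gadget a′ b m′ M′ → Gadget (a + a′) b (m * m′) (M + M′)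
_⊗_ {a} {a′} {b} {m} {m′} {M} {M′} g g′ = record
  { width             = width g + width g′
  ; minterm           = λ i → minterm⊗ (remQuot m′ i)
  ; maxterm           = λ j → maxterm⊗ (splitAt M j)
  ; minterm-injective = λ i → ⊎-injective (minterm-injective g (proj₁ (remQuot m′ i)))
                                          (minterm-injective g′ (proj₂ (remQuot {m} m′ i)))
  ; maxterm-injective = λ j → maxterm⊗-injective (splitAt M j)
  ; dichotomy         = dichotomy⊗
  }
  where
  left : Fin (width g) → Fin (width g + width g′)
  left = _↑ˡ width g′
  right : Fin (width g′) → Fin (width g + width g′)
  right = width g ↑ʳ_
  minterm⊗ : Fin m × Fin m′ → Fin (a + a′) → Fin (width g + width g′)
  minterm⊗ (i , i′) x = [ left ∘ minterm g i , right ∘ minterm g′ i′ ]′ (splitAt a x)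
  maxterm⊗ : Fin M ⊎ Fin M′ → Fin b → Fin (width g + width g′)
  maxterm⊗ (inj₁ j) = left ∘ maxterm g j
  maxterm⊗ (inj₂ j) = right ∘ maxterm g′ j
  maxterm⊗-injective : ∀ j → Injective _≡_ _≡_ (maxterm⊗ j)
  maxterm⊗-injective (inj₁ j) e = maxterm-injective g j (↑ˡ-injective (width g′) _ _ e)
  maxterm⊗-injective (inj₂ j) e = maxterm-injective g′ j (↑ʳ-injective (width g) _ _ e)
  dichotomy⊗ : (U : Fin (width g + width g′) → Bool) →
    (∃ λ i → ∀ x → U (minterm⊗ (remQuot m′ i) x) ≡ true) ⊎ (∃ λ j → ∀ y → U (maxterm⊗ (splitAt M j) y) ≡ false)
  dichotomy⊗ U with dichotomy g (U ∘ left) | dichotomy g′ (U ∘ right)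
  ... | inj₂ (j , h) | _ = inj₂ (j ↑ˡ M′ , subst (λ s → ∀ y → U (maxterm⊗ s y) ≡ false) (sym (splitAt-↑ˡ M j M′)) h)
  ... | inj₁ _ | inj₂ (j , h) = inj₂ (M ↑ʳ j , subst (λ s → ∀ y → U (maxterm⊗ s y) ≡ false) (sym (splitAt-↑ʳ M M′ j)) h)
  ... | inj₁ (i , h) | inj₁ (i′ , h′) = inj₁ (combine i i′ ,
    subst (λ s → ∀ x → U (minterm⊗ s x) ≡ true) (sym (remQuot-combine i i′)) both)
    where
    both : ∀ x → U (minterm⊗ (i , i′) x) ≡ true
    both x with splitAt a x
    ... | inj₁ y = h y
    ... | inj₂ y = h′ y

power : ∀ {a b m M} → Gadget a b m M → ∀ q → Gadget (q * a) b (m ^ q) (q * M)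
-- The empty AND is constantly true: one empty minterm and no maxterm.
power g zero = record
  { width             = 0
  ; minterm           = λ _ ()
  ; maxterm           = λ ()
  ; minterm-injective = λ { _ {()} }
  ; maxterm-injective = λ ()
  ; dichotomy         = λ _ → inj₁ (zero , λ ())
  }
power g (suc q) = g ⊗ power g q

-- An OR of q copies of an AND of q copies. Using the same fan-in twice keeps minterms and maxterms
-- equally large.
block : ∀ {a b m M} → Gadget a b m M → ∀ q → Gadget (q * a) (q * b) (q * m ^ q) ((q * M) ^ q)
block g q = dual (power (dual (power g q)) q)

singleton : Gadget 1 1 1 1
singleton = record
  { width             = 1
  ; minterm           = λ _ x → x
  ; maxterm           = λ _ y → y
  ; minterm-injective = λ _ e → e
  ; maxterm-injective = λ _ e → e
  ; dichotomy         = split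
  }
  where
  split : (U : Fin 1 → Bool) → (∃ λ (i : Fin 1) → ∀ x → U x ≡ true) ⊎ (∃ λ (j : Fin 1) → ∀ y → U y ≡ false)
  split U with U zero in eq
  ... | true  = inj₁ (zero , λ { zero → eq })
  ... | false = inj₂ (zero , λ { zero → eq })

-- Numbers of minterms and maxterms of the balanced tree.

#min #max : ℕ → ℕ
#min zero    = 1
#min (suc j) = 2 * #min j ^ 2
#max zero    = 1
#max (suc j) = (2 * #max j) ^ 2

tower : ∀ j → Gadget (2 ^ j) (2 ^ j) (#min j) (#max j)
tower zero    = singleton
tower (suc j) = block (tower j) 2

-- The factor 2 turns the recursion x to 2x² into plain squaring; for `#max`, with x to (2x)², the
-- factor 4 does the same. Hence the bases 2 and 4 of the two counts.
2*#min≡ : ∀ j → 2 * #min j ≡ 2 ^ 2 ^ j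
2*#min≡ zero    = refl
2*#min≡ (suc j) = begin
  2 * (2 * #min j ^ 2)  ≡⟨ lemma (#min j) ⟩
  (2 * #min j) ^ 2      ≡⟨ cong (_^ 2) (2*#min≡ j) ⟩
  (2 ^ 2 ^ j) ^ 2       ≡⟨ ^-*-assoc 2 (2 ^ j) 2 ⟩
  2 ^ (2 ^ j * 2)       ≡⟨ cong (2 ^_) (*-comm (2 ^ j) 2) ⟩
  2 ^ 2 ^ suc j         ∎
  where
  open ≡-Reasoning
  lemma : ∀ x → 2 * (2 * (x * (x * 1))) ≡ (2 * x) * ((2 * x) * 1)
  lemma = solve-∀

4*#max≡ : ∀ j → 4 * #max j ≡ 2 ^ (2 * 2 ^ j)
4*#max≡ zero    = refl
4*#max≡ (suc j) = begin
  4 * (2 * #max j) ^ 2   ≡⟨ lemma (#max j) ⟩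
  (4 * #max j) ^ 2       ≡⟨ cong (_^ 2) (4*#max≡ j) ⟩
  (2 ^ (2 ^ suc j)) ^ 2  ≡⟨ ^-*-assoc 2 (2 ^ suc j) 2 ⟩
  2 ^ (2 ^ suc j * 2)    ≡⟨ cong (2 ^_) (*-comm (2 ^ suc j) 2) ⟩
  2 ^ (2 * 2 ^ suc j)    ∎
  where
  open ≡-Reasoning
  lemma : ∀ x → 4 * ((2 * x) * ((2 * x) * 1)) ≡ (4 * x) * ((4 * x) * 1)
  lemma = solve-∀

n<2^n : ∀ n → n < 2 ^ n
n<2^n zero    = ≤-refl
n<2^n (suc n) = +-mono-≤ (m^n>0 2 n) (≤-trans (n<2^n n) (≤-reflexive (sym (+-identityʳ (2 ^ n)))))

n≤2^n : ∀ n → n ≤ 2 ^ n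
n≤2^n n = <⇒≤ (n<2^n n)

#min-block≤ : ∀ j q → q * #min j ^ q ≤ 2 ^ (q + q * 2 ^ j)
#min-block≤ j q = begin
  q * #min j ^ q               ≤⟨ *-mono-≤ (n≤2^n q) (^-monoˡ-≤ q (≤-trans (m≤m+n _ _) (≤-reflexive (2*#min≡ j)))) ⟩
  2 ^ q * (2 ^ 2 ^ j) ^ q      ≡⟨ cong (2 ^ q *_) (^-*-assoc 2 (2 ^ j) q) ⟩
  2 ^ q * 2 ^ (2 ^ j * q)      ≡⟨ ^-distribˡ-+-* 2 q (2 ^ j * q) ⟨
  2 ^ (q + 2 ^ j * q)          ≡⟨ cong (λ x → 2 ^ (q + x)) (*-comm (2 ^ j) q) ⟩
  2 ^ (q + q * 2 ^ j)          ∎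
  where open ≤-Reasoning

#max-block≤ : ∀ j q → (q * #max j) ^ q ≤ 2 ^ (q * q + 2 * (q * 2 ^ j))
#max-block≤ j q = begin
  (q * #max j) ^ q                     ≤⟨ ^-monoˡ-≤ q (*-mono-≤ (n≤2^n q) (≤-trans (m≤m+n _ _) (≤-reflexive (4*#max≡ j)))) ⟩
  (2 ^ q * 2 ^ (2 * 2 ^ j)) ^ q        ≡⟨ cong (_^ q) (^-distribˡ-+-* 2 q (2 * 2 ^ j)) ⟨
  (2 ^ (q + 2 * 2 ^ j)) ^ q            ≡⟨ ^-*-assoc 2 (q + 2 * 2 ^ j) q ⟩
  2 ^ ((q + 2 * 2 ^ j) * q)            ≡⟨ cong (2 ^_) (lemma q (2 ^ j)) ⟩
  2 ^ (q * q + 2 * (q * 2 ^ j))        ∎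
  where
  open ≤-Reasoning
  lemma : ∀ q x → (q + 2 * x) * q ≡ q * q + 2 * (q * x)
  lemma = solve-∀

-- Sampling the sparse set B and its lists

⌊⌋-true : ∀ {P : Set} (d : Dec P) → P → ⌊ d ⌋ ≡ true
⌊⌋-true (yes _) _ = refl
⌊⌋-true (no ¬p) p = contradiction p ¬p

true-⌊⌋ : ∀ {P : Set} (d : Dec P) → ⌊ d ⌋ ≡ true → P
true-⌊⌋ (yes p) _ = p

true-not : ∀ {b} → not b ≡ true → b ≡ false
true-not {false} _ = refl

-- The exceptional b + f stays below 3N/8, leaving a > 5N/8, while 2mhb < 3N/8 and 2m ≤ N/16 add up
-- to at most 7N/16.
sample-size : ∀ m h N a b f → 1 ≤ 16 * (m * h) → 16 * (m * h) * b + 8 * f < 3 * N → N ≤ a + b + f → 32 * m ≤ N →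
  2 * m * (h * b + 1) ≤ a
sample-size m h N a b f 1≤16mh few cover 32m≤N = *-cancelˡ-≤ {x} {a} 16 (+-cancelʳ-≤ (9 * N) (16 * x) (16 * a) (begin
  16 * x + 9 * N                  ≡⟨ cong (_+ 9 * N) (lemma₁ 16 m h b) ⟩
  2 * y + 32 * m + 9 * N          ≤⟨ +-monoˡ-≤ (9 * N) (+-mono-≤ (*-monoʳ-≤ 2 (≤-trans (m≤m+n y (8 * f)) (<⇒≤ few))) 32m≤N) ⟩
  2 * (3 * N) + N + 9 * N         ≡⟨ lemma₂ N ⟩
  16 * N                          ≤⟨ *-monoʳ-≤ 16 cover ⟩
  16 * (a + b + f)                ≡⟨ lemma₃ a b f ⟩
  16 * a + (16 * b + 16 * f)      ≤⟨ +-monoʳ-≤ (16 * a) (+-monoˡ-≤ (16 * f) (*-monoˡ-≤ b (16≤16* (m * h) 1≤16mh))) ⟩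
  16 * a + (y + 16 * f)           ≤⟨ +-monoʳ-≤ (16 * a) (+-monoˡ-≤ (16 * f) (m≤n*m y 2)) ⟩
  16 * a + (2 * y + 16 * f)       ≡⟨ lemma₄ a y f ⟩
  16 * a + 2 * (y + 8 * f)        ≤⟨ +-monoʳ-≤ (16 * a) (*-monoʳ-≤ 2 (<⇒≤ few)) ⟩
  16 * a + 2 * (3 * N)            ≤⟨ +-monoʳ-≤ (16 * a) (m≤m+n (2 * (3 * N)) (3 * N)) ⟩
  16 * a + (2 * (3 * N) + 3 * N)  ≡⟨ cong (16 * a +_) (lemma₅ N) ⟩
  16 * a + 9 * N                  ∎))
  where
  open ≤-Reasoning
  x = 2 * m * (h * b + 1)
  y = 16 * (m * h) * b
  16≤16* : ∀ k → 1 ≤ 16 * k → 16 ≤ 16 * k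
  16≤16* (suc k) _ = *-monoʳ-≤ 16 {1} {suc k} (s≤s z≤n)
  lemma₁ : ∀ c m h b → c * (2 * m * (h * b + 1)) ≡ 2 * (c * (m * h) * b) + (c * 2) * m
  lemma₁ = solve-∀
  lemma₂ : ∀ n → 2 * (3 * n) + n + 9 * n ≡ 16 * n
  lemma₂ = solve-∀
  lemma₃ : ∀ a b f → 16 * (a + b + f) ≡ 16 * a + (16 * b + 16 * f)
  lemma₃ = solve-∀
  lemma₄ : ∀ a x f → 16 * a + (2 * x + 16 * f) ≡ 16 * a + 2 * (x + 8 * f)
  lemma₄ = solve-∀
  lemma₅ : ∀ n → 2 * (3 * n) + 3 * n ≡ 9 * n
  lemma₅ = solve-∀

-- Each vertex draws one element of `Fin Q`, read as a pair: the first component decides membership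
-- in B with probability 1/Q′, the second is the index of a maxterm. In `s = r + β + 3` the terms
-- pay for the threshold 2^r, the union over M types, and the weight 8 of a failing vertex.
module Sampling {N} (adj : Fin N → Fin N → Bool) (K M′ r β : ℕ) (M≤2^β : suc M′ ≤ 2 ^ β) (1≤N : 1 ≤ N)
  (degree≥ : ∀ v → suc K * suc M′ * 2 * (r + β + 3) ≤ ♯ (adj v)) where
  open ≤-Reasoning
  M = suc M′
  Q′ = suc K
  Q = Q′ * M
  s = r + β + 3

  inB : Fin Q → Bool
  inB x = ⌊ proj₁ (remQuot {Q′} M x) ≟ zero ⌋
  type : Fin Q → Fin M
  type x = proj₂ (remQuot {Q′} M x)
  hit : Fin M → Fin Q → Bool
  hit i x = inB x ∧ ⌊ type x ≟ i ⌋
  -- The product W v i of the weights is 2 ^ (N - number of hits), so a small W v i certifies many hits.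
  weight : (v : Fin N) → Fin M → (u : Fin N) → Fin Q → ℕ
  weight v i u x = if adj v u ∧ hit i x then 1 else 2
  W : Fin N → Fin M → Vec (Fin Q) N → ℕ
  W v i g = product (λ u → weight v i u (lookup g u))
  -- A penalty for lying in B plus one for missing some type. Each has average at most 2^N, so the
  -- target 3N 2^N for the total is beaten strictly.
  F : Fin N → Vec (Fin Q) N → ℕ
  F v g = Q′ * 2 ^ N * ⟦ inB (lookup g v) ⟧ + 8 * 2 ^ r * sum (λ i → W v i g)

  -- For a neighbour, the outcome `combine zero i` is a hit and lowers the total 2Q by one, so
  -- `product-gap` applies with 1 + a = 2Q.
  ∑weight : ∀ v i u → sum (weight v i u) ≤ (if adj v u then suc (pred Q * 2) else Q * 2)
  ∑weight v i u with adj v u in eq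
  ... | true  = s≤s⁻¹ (sum-<-const {Q} (λ x → w≤2 x) (combine {Q′} zero i) hit<2)
    where
    w≤2 : ∀ x → (if hit i x then 1 else 2) ≤ 2
    w≤2 x with hit i x
    ... | true  = s≤s z≤n
    ... | false = ≤-refl
    hit<2 : (if hit i (combine {Q′} zero i) then 1 else 2) < 2
    hit<2 = ≤-reflexive (cong (λ b → suc (if b then 1 else 2))
      (trans (cong (λ p → ⌊ proj₁ p ≟ zero ⌋ ∧ ⌊ proj₂ p ≟ i ⌋) (remQuot-combine {Q′} {M} zero i)) (⌊⌋-true (i ≟ i) refl)))
  ... | false = ≤-reflexive (sum-const Q 2)

  ∑W : ∀ v i → ∑ᵛ N (W v i) * 2 ^ s ≤ (Q * 2) ^ N
  ∑W v i = begin
    ∑ᵛ N (W v i) * 2 ^ s                        ≡⟨ cong (_* 2 ^ s) (∑ᵛ-product N (weight v i)) ⟩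
    product (λ u → sum (weight v i u)) * 2 ^ s  ≤⟨ product-gap (suc (pred Q * 2)) s (adj v) _ (∑weight v i) (degree≥ v) ⟩
    (Q * 2) ^ N                                 ∎

  ∑inB : sum (⟦_⟧ ∘ inB) ≡ M
  ∑inB = trans (sum-combine Q′ {M} inB#) (trans (cong₂ _+_ first rest) (+-identityʳ M))
    where
    inB# : Fin Q → ℕ
    inB# x = ⟦ inB x ⟧
    first : sum (λ j → inB# (combine {Q′} zero j)) ≡ M
    first = trans (sum-cong-≗ {M} λ j → cong (λ p → ⟦ ⌊ proj₁ p ≟ zero ⌋ ⟧) (remQuot-combine {Q′} {M} zero j))
                  (trans (sum-const M 1) (*-identityʳ M))
    rest : sum (λ a → sum (λ j → inB# (combine {Q′} (suc a) j))) ≡ 0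
    rest = trans (sum-cong-≗ {pred Q′} λ a → trans
             (sum-cong-≗ {M} λ j → cong (λ p → ⟦ ⌊ proj₁ p ≟ zero ⌋ ⟧) (remQuot-combine {Q′} {M} (suc a) j))
             (sum-replicate-zero M)) (sum-replicate-zero (pred Q′))

  ∑B : ∀ v → Q′ * ∑ᵛ N (λ g → ⟦ inB (lookup g v) ⟧) ≡ Q ^ N
  ∑B v = *-cancelʳ-≡ _ _ M (trans (*-swapʳ Q′ _ M) (trans (∑ᵛ-lookup N (⟦_⟧ ∘ inB) v) (cong (Q ^ N *_) ∑inB)))

  ∑∑W : ∀ v → ∑ᵛ N (λ g → 8 * 2 ^ r * sum (λ i → W v i g)) ≤ 2 ^ N * Q ^ N
  ∑∑W v = *-cancelˡ-≤ (2 ^ β) ⦃ m^n≢0 2 β ⦄ (begin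
    2 ^ β * ∑ᵛ N (λ g → 8 * 2 ^ r * sum (λ i → W v i g))
      ≡⟨ cong (2 ^ β *_) (∑ᵛ-*ˡ N (8 * 2 ^ r) (λ g → sum (λ i → W v i g))) ⟨
    2 ^ β * (8 * 2 ^ r * ∑ᵛ N (λ g → sum (λ i → W v i g)))
      ≡⟨ cong (λ z → 2 ^ β * (8 * 2 ^ r * z)) (∑ᵛ-sum N (λ g i → W v i g)) ⟩
    2 ^ β * (8 * 2 ^ r * sum (λ i → ∑ᵛ N (W v i)))
      ≡⟨ lemma (2 ^ β) (2 ^ r) _ ⟩
    sum (λ i → ∑ᵛ N (W v i)) * (2 ^ r * 2 ^ β * 2 ^ 3)
      ≡⟨ cong (sum (λ i → ∑ᵛ N (W v i)) *_) 2^s ⟨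
    sum (λ i → ∑ᵛ N (W v i)) * 2 ^ s
      ≡⟨ *-distribʳ-sum (2 ^ s) (λ i → ∑ᵛ N (W v i)) ⟩
    sum (λ i → ∑ᵛ N (W v i) * 2 ^ s)
      ≤⟨ sum-≤-const (∑W v) ⟩
    M * (Q * 2) ^ N
      ≤⟨ *-mono-≤ M≤2^β (≤-reflexive (trans (^-distribʳ-* Q 2 N) (*-comm (Q ^ N) (2 ^ N)))) ⟩
    2 ^ β * (2 ^ N * Q ^ N)  ∎)
    where
    lemma : ∀ a b x → a * (8 * b * x) ≡ x * (b * a * 8)
    lemma = solve-∀
    2^s : 2 ^ s ≡ 2 ^ r * 2 ^ β * 2 ^ 3
    2^s = trans (^-distribˡ-+-* 2 (r + β) 3) (cong (_* 8) (^-distribˡ-+-* 2 r β))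

  ∑F : ∑ᵛ N (λ g → sum (λ v → F v g)) < Q ^ N * (3 * N * 2 ^ N)
  ∑F = begin-strict
    ∑ᵛ N (λ g → sum (λ v → F v g))      ≡⟨ ∑ᵛ-sum N (λ g v → F v g) ⟩
    sum (λ v → ∑ᵛ N (F v))              ≤⟨ sum-≤-const (λ v → ∑Fv v) ⟩
    N * (2 ^ N * Q ^ N + 2 ^ N * Q ^ N) ≡⟨ lemma₁ N (2 ^ N) (Q ^ N) ⟩
    0 + Q ^ N * (2 * N * 2 ^ N)         <⟨ +-monoˡ-< (Q ^ N * (2 * N * 2 ^ N)) (*-mono-≤ (m^n>0 Q N) (*-mono-≤ 1≤N (m^n>0 2 N))) ⟩
    Q ^ N * (N * 2 ^ N) + Q ^ N * (2 * N * 2 ^ N) ≡⟨ lemma₂ N (2 ^ N) (Q ^ N) ⟩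
    Q ^ N * (3 * N * 2 ^ N)             ∎
    where
    lemma₁ : ∀ n a b → n * (a * b + a * b) ≡ 0 + b * (2 * n * a)
    lemma₁ = solve-∀
    lemma₂ : ∀ n a b → b * (n * a) + b * (2 * n * a) ≡ b * (3 * n * a)
    lemma₂ = solve-∀
    lemma₃ : ∀ a b c → a * b * c ≡ b * (a * c)
    lemma₃ = solve-∀
    ∑Fv : ∀ v → ∑ᵛ N (F v) ≤ 2 ^ N * Q ^ N + 2 ^ N * Q ^ N
    ∑Fv v = begin
      ∑ᵛ N (F v)
        ≡⟨ ∑ᵛ-+ N (λ g → Q′ * 2 ^ N * ⟦ inB (lookup g v) ⟧) (λ g → 8 * 2 ^ r * sum (λ i → W v i g)) ⟩
      ∑ᵛ N (λ g → Q′ * 2 ^ N * ⟦ inB (lookup g v) ⟧) + ∑ᵛ N (λ g → 8 * 2 ^ r * sum (λ i → W v i g))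
        ≤⟨ +-mono-≤ (≤-reflexive (trans (sym (∑ᵛ-*ˡ N (Q′ * 2 ^ N) (λ g → ⟦ inB (lookup g v) ⟧)))
             (trans (lemma₃ Q′ (2 ^ N) _) (cong (2 ^ N *_) (∑B v))))) (∑∑W v) ⟩
      2 ^ N * Q ^ N + 2 ^ N * Q ^ N ∎

  good : ∃ λ g → sum (λ v → F v g) < 3 * N * 2 ^ N
  good = ∑ᵛ-below-average N (λ g → sum (λ v → F v g)) (3 * N * 2 ^ N) ∑F

  module Outcome (g : Vec (Fin Q) N) (light : sum (λ v → F v g) < 3 * N * 2 ^ N) where
    B : Fin N → Bool
    B = inB ∘ lookup g
    c : Fin N → Fin M
    c = type ∘ lookup g
    count : Fin N → Fin M → ℕ
    count v i = ♯ (λ u → adj v u ∧ (B u ∧ ⌊ c u ≟ i ⌋))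
    enough? : ∀ v → Dec (∀ i → r ≤ count v i)
    enough? v = all? (λ i → r ≤? count v i)
    fail : Fin N → Bool
    fail v = not ⌊ enough? v ⌋
    A : Fin N → Bool
    A v = not (B v) ∧ ⌊ enough? v ⌋

    disjoint : ∀ v → A v ≡ true → B v ≡ false
    disjoint v = true-not ∘ proj₁ ∘ ∧-true
    frequent : ∀ v → A v ≡ true → ∀ i → r ≤ count v i
    frequent v Av = true-⌊⌋ (enough? v) (proj₂ (∧-true {not (B v)} Av))

    -- A failing vertex has fewer than r hits of some type i, so `W v i g` is at least 2^(N-r),
    -- which the factor 2^r lifts to 2^N.
    bad≤F : ∀ v → (Q′ * ⟦ B v ⟧ + 8 * ⟦ fail v ⟧) * 2 ^ N ≤ F v g
    bad≤F v = begin
      (Q′ * ⟦ B v ⟧ + 8 * ⟦ fail v ⟧) * 2 ^ N            ≡⟨ lemma Q′ ⟦ B v ⟧ ⟦ fail v ⟧ (2 ^ N) ⟩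
      Q′ * 2 ^ N * ⟦ B v ⟧ + 8 * (⟦ fail v ⟧ * 2 ^ N)    ≤⟨ +-monoʳ-≤ (Q′ * 2 ^ N * ⟦ B v ⟧) (*-monoʳ-≤ 8 fail≤) ⟩
      Q′ * 2 ^ N * ⟦ B v ⟧ + 8 * (2 ^ r * ∑W′)           ≡⟨ cong (Q′ * 2 ^ N * ⟦ B v ⟧ +_) (*-assoc 8 (2 ^ r) ∑W′) ⟨
      F v g                                              ∎
      where
      ∑W′ = sum (λ i → W v i g)
      lemma : ∀ q b f x → (q * b + 8 * f) * x ≡ q * x * b + 8 * (f * x)
      lemma = solve-∀
      fail≤ : ⟦ fail v ⟧ * 2 ^ N ≤ 2 ^ r * ∑W′
      fail≤ with enough? v
      ... | yes _ = z≤n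
      ... | no ¬enough with ¬∀⟶∃¬ M _ (λ i → r ≤? count v i) ¬enough
      ...   | i , r≰count = begin
        2 ^ N + 0                    ≡⟨ +-identityʳ (2 ^ N) ⟩
        2 ^ N                        ≡⟨ product-half (λ u → adj v u ∧ hit i (lookup g u)) ⟨
        W v i g * 2 ^ count v i      ≤⟨ *-mono-≤ (term≤sum (λ i → W v i g) i) (^-monoʳ-≤ 2 (<⇒≤ (≰⇒> r≰count))) ⟩
        ∑W′ * 2 ^ r                  ≡⟨ *-comm ∑W′ (2 ^ r) ⟩
        2 ^ r * ∑W′                  ∎

    few : Q′ * ♯ B + 8 * ♯ fail < 3 * N
    few = *-cancelʳ-< (2 ^ N) (Q′ * ♯ B + 8 * ♯ fail) (3 * N) (begin-strict
      (Q′ * ♯ B + 8 * ♯ fail) * 2 ^ N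
        ≡⟨ cong (_* 2 ^ N) (cong₂ _+_ (*-distribˡ-sum Q′ (⟦_⟧ ∘ B)) (*-distribˡ-sum 8 (⟦_⟧ ∘ fail))) ⟩
      (sum (λ v → Q′ * ⟦ B v ⟧) + sum (λ v → 8 * ⟦ fail v ⟧)) * 2 ^ N
        ≡⟨ cong (_* 2 ^ N) (∑-distrib-+ (λ v → Q′ * ⟦ B v ⟧) (λ v → 8 * ⟦ fail v ⟧)) ⟨
      sum (λ v → Q′ * ⟦ B v ⟧ + 8 * ⟦ fail v ⟧) * 2 ^ N
        ≡⟨ *-distribʳ-sum (2 ^ N) (λ v → Q′ * ⟦ B v ⟧ + 8 * ⟦ fail v ⟧) ⟩
      sum (λ v → (Q′ * ⟦ B v ⟧ + 8 * ⟦ fail v ⟧) * 2 ^ N)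
        ≤⟨ sum-mono-≤ bad≤F ⟩
      sum (λ v → F v g)
        <⟨ light ⟩
      3 * N * 2 ^ N ∎)

    cover : N ≤ ♯ A + ♯ B + ♯ fail
    cover = begin
      N                                                     ≡⟨ trans (sum-const N 1) (*-identityʳ N) ⟨
      sum {N} (λ _ → 1)                                     ≤⟨ sum-mono-≤ (λ v → cases (B v) ⌊ enough? v ⌋) ⟩
      sum (λ v → ⟦ A v ⟧ + ⟦ B v ⟧ + ⟦ fail v ⟧)            ≡⟨ ∑-distrib-+ (λ v → ⟦ A v ⟧ + ⟦ B v ⟧) (⟦_⟧ ∘ fail) ⟩
      sum (λ v → ⟦ A v ⟧ + ⟦ B v ⟧) + ♯ fail                ≡⟨ cong (_+ ♯ fail) (∑-distrib-+ (⟦_⟧ ∘ A) (⟦_⟧ ∘ B)) ⟩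
      ♯ A + ♯ B + ♯ fail                                    ∎
      where
      cases : ∀ b e → 1 ≤ ⟦ not b ∧ e ⟧ + ⟦ b ⟧ + ⟦ not e ⟧
      cases true  _     = s≤s z≤n
      cases false true  = s≤s z≤n
      cases false false = s≤s z≤n

-- The last conclusion is shaped as the hypothesis of `product-gap` with 1 + a = 2m and s = h |B| +
-- 1.
sampling : ∀ {N} (adj : Fin N → Fin N → Bool) m h K M′ r β →
  let Q′ = suc K ; M = suc M′ in
  16 * (m * h) ≡ Q′ → M ≤ 2 ^ β → 1 ≤ N → 32 * m ≤ N →
  (∀ v → Q′ * M * 2 * (r + β + 3) ≤ ♯ (adj v)) →
  Σ (Fin N → Bool) λ A → Σ (Fin N → Bool) λ B → Σ (Fin N → Fin M) λ c →
    (∀ v → A v ≡ true → B v ≡ false) ×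
    (∀ v → A v ≡ true → ∀ i → r ≤ ♯ (λ u → adj v u ∧ (B u ∧ ⌊ c u ≟ i ⌋))) ×
    2 * m * (h * ♯ B + 1) ≤ ♯ A
sampling {N} adj m h K M′ r β 16mh≡Q′ M≤2^β 1≤N 32m≤N degree≥ = outcome good
  where
  open Sampling adj K M′ r β M≤2^β 1≤N degree≥
  outcome : (∃ λ g → sum (λ v → F v g) < 3 * N * 2 ^ N) → _
  outcome (g , light) = A , B , c , disjoint , frequent ,
    sample-size m h N (♯ A) (♯ B) (♯ fail) (subst (λ q → 1 ≤ q) (sym 16mh≡Q′) (s≤s z≤n))
      (subst (λ q → q * ♯ B + 8 * ♯ fail < 3 * N) (sym 16mh≡Q′) few) cover 32m≤N
    where open Outcome g light

-- The union bound

enumerate : ∀ {n} (S : Fin n → Bool) →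
  Σ (Fin (♯ S) → Fin n) λ e → ∀ u → S u ≡ true → ∃ λ i → e i ≡ u
enumerate {zero}  S = (λ ()) , λ ()
enumerate {suc n} S with S zero in S₀ | enumerate (S ∘ suc)
... | true  | e , onto = (λ { zero → zero ; (suc i) → suc (e i) }) ,
  λ { zero _ → zero , refl ; (suc u) Su → let i , eᵢ≡u = onto u Su in suc i , cong suc eᵢ≡u }
... | false | e , onto = suc ∘ e ,
  λ { zero S₀′ → contradiction (trans (sym S₀) S₀′) (λ ()) ; (suc u) Su → let i , eᵢ≡u = onto u Su in i , cong suc eᵢ≡u }

-- Renumbering the vertices of `S` makes the exponent `♯ S` instead of `N`, while the orientation
-- keeps one bit for every ordered pair.
acyclic-orientations-of : ∀ {N} (edge : Fin N → Fin N → Bool) (S : Fin N → Bool) →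
  (∀ a b → edge a b ≡ true → S a ≡ true × S b ≡ true) →
  (P : Vec (Fin 2) (N * N) → Bool) →
  (∀ o → P o ≡ true → Σ (Fin N → ℕ) λ π → ∀ a b → edge a b ≡ true → PointsAlong (lookup o (combine a b)) (π a) (π b)) →
  let r = sum (♯ ∘ edge) in satisfying P * 4 ^ r ≤ 2 ^ ♯ S * 3 ^ r * 2 ^ (N * N)
acyclic-orientations-of {N} edge S inS P acyclic =
  subst (λ r → satisfying P * 4 ^ r ≤ 2 ^ ♯ S * 3 ^ r * 2 ^ (N * N)) size
    (acyclic-orientations (N * N) (♯ S) edges P λ o Po → let π , isπ = acyclic o Po in π ∘ emb , potential o π isπ)
  where
  emb = proj₁ (enumerate S)
  onto = proj₂ (enumerate S)
  edgeIf : ∀ a b x → edge a b ≡ x → Maybe (Fin (♯ S) × Fin (♯ S))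
  edgeIf a b true  ab = just (proj₁ (onto a (proj₁ (inS a b ab))) , proj₁ (onto b (proj₂ (inS a b ab))))
  edgeIf a b false _  = nothing
  edgeAt : ∀ a b → Maybe (Fin (♯ S) × Fin (♯ S))
  edgeAt a b = edgeIf a b (edge a b) refl
  edges : Edges (N * N) (♯ S)
  edges i = edgeAt (proj₁ (remQuot {N} N i)) (proj₂ (remQuot {N} N i))
  is-just-edgeIf : ∀ a b x ab → is-just (edgeIf a b x ab) ≡ x
  is-just-edgeIf a b true  _ = refl
  is-just-edgeIf a b false _ = refl
  size : ♯ (is-just ∘ edges) ≡ sum (♯ ∘ edge)
  size = trans (sum-combine N (⟦_⟧ ∘ is-just ∘ edges)) (sum-cong-≗ {N} λ a → sum-cong-≗ {N} λ b → trans
    (cong (λ p → ⟦ is-just (edgeAt (proj₁ p) (proj₂ p)) ⟧) (remQuot-combine {N} a b)) (cong ⟦_⟧ (is-just-edgeIf a b _ refl)))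
  edgeIf⁻ : ∀ a b x ab {i j} → edgeIf a b x ab ≡ just (i , j) → x ≡ true × emb i ≡ a × emb j ≡ b
  edgeIf⁻ a b true ab refl = refl , proj₂ (onto a _) , proj₂ (onto b _)
  potential : ∀ o π → (∀ a b → edge a b ≡ true → PointsAlong (lookup o (combine a b)) (π a) (π b)) →
    IsPotential edges o (π ∘ emb)
  potential o π isπ i eq with edgeIf⁻ (proj₁ (remQuot {N} N i)) (proj₂ (remQuot {N} N i)) _ refl eq
  ... | ab , x≡a , y≡b = subst₂ (λ a b → PointsAlong (lookup o i) (π a) (π b)) (sym x≡a) (sym y≡b)
    (subst (λ j → PointsAlong (lookup o j) (π (proj₁ (remQuot {N} N i))) (π (proj₂ (remQuot {N} N i))))
      (combine-remQuot {N} N i) (isπ _ _ ab))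

up : Fin 2 → Bool
up zero    = false
up (suc _) = true

orient : ∀ {N} → (Fin N → Fin N → Bool) → Vec (Fin 2) (N * N) → Fin N → Fin N → Bool
orient edge o u v = (edge u v ∧ up (lookup o (combine u v))) ∨ (edge v u ∧ not (up (lookup o (combine v u))))

acyclic : ∀ {N} → (Fin N → Fin N → Bool) → Vec (Fin 2) (N * N) → Bool
acyclic edge o with potential-or-cycle (orient edge o)
... | inj₁ _ = true
... | inj₂ _ = false

-- The t edges at each vertex of `S` contribute (3/4)^t ≤ 1/(4κ); one factor 2 of this cancels that
-- vertex's share of 2^(♯ S + ♯ B).
few-acyclic : ∀ {N} (edge : Fin N → Fin N → Bool) (S B : Fin N → Bool) κ t →
  (∀ a b → edge a b ≡ true → S a ≡ true × B b ≡ true) →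
  (∀ a → S a ≡ true → t ≤ ♯ (edge a)) →
  3 ^ t * (2 * (2 * κ)) ≤ 4 ^ t →
  satisfying (acyclic edge) * (2 * κ) ^ ♯ S ≤ 2 ^ (N * N) * 2 ^ ♯ B
few-acyclic {N} edge S B κ t inSB dense gap = *-cancelʳ-≤ _ _ (4 ^ r) ⦃ m^n≢0 4 r ⦄ (begin
  count * (2 * κ) ^ s * 4 ^ r                             ≡⟨ *-swapʳ count ((2 * κ) ^ s) (4 ^ r) ⟩
  count * 4 ^ r * (2 * κ) ^ s                             ≤⟨ *-monoˡ-≤ ((2 * κ) ^ s) (acyclic-orientations-of edge S∪B inS∪B (acyclic edge) acyclic⇒potential) ⟩
  2 ^ ♯ S∪B * 3 ^ r * 2 ^ (N * N) * (2 * κ) ^ s           ≤⟨ *-monoˡ-≤ ((2 * κ) ^ s) (*-monoˡ-≤ (2 ^ (N * N)) (*-monoˡ-≤ (3 ^ r) 2^♯S∪B≤)) ⟩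
  2 ^ s * 2 ^ ♯ B * 3 ^ r * 2 ^ (N * N) * (2 * κ) ^ s     ≡⟨ lemma (2 ^ s) (2 ^ ♯ B) (3 ^ r) (2 ^ (N * N)) ((2 * κ) ^ s) ⟩
  2 ^ (N * N) * 2 ^ ♯ B * (3 ^ r * (2 ^ s * (2 * κ) ^ s)) ≡⟨ cong (λ x → 2 ^ (N * N) * 2 ^ ♯ B * (3 ^ r * x)) (^-distribʳ-* 2 (2 * κ) s) ⟨
  2 ^ (N * N) * 2 ^ ♯ B * (3 ^ r * (2 * (2 * κ)) ^ s)     ≤⟨ *-monoʳ-≤ (2 ^ (N * N) * 2 ^ ♯ B) (gaps r ts≤r) ⟩
  2 ^ (N * N) * 2 ^ ♯ B * 4 ^ r                           ∎)
  where
  open ≤-Reasoning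
  count = satisfying (acyclic edge)
  r = sum (♯ ∘ edge)
  s = ♯ S
  S∪B : Fin N → Bool
  S∪B v = S v ∨ B v
  inS∪B : ∀ a b → edge a b ≡ true → S∪B a ≡ true × S∪B b ≡ true
  inS∪B a b ab with inSB a b ab
  ... | Sa , Bb rewrite Sa | Bb = refl , ∨-zeroʳ (S b)
  2^♯S∪B≤ : 2 ^ ♯ S∪B ≤ 2 ^ s * 2 ^ ♯ B
  2^♯S∪B≤ = ≤-trans (^-monoʳ-≤ 2 (≤-trans (sum-mono-≤ λ v → ∨≤+ (S v) (B v))
    (≤-reflexive (∑-distrib-+ (⟦_⟧ ∘ S) (⟦_⟧ ∘ B))))) (≤-reflexive (^-distribˡ-+-* 2 s (♯ B)))
    where
    ∨≤+ : ∀ x y → ⟦ x ∨ y ⟧ ≤ ⟦ x ⟧ + ⟦ y ⟧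
    ∨≤+ true  y = s≤s z≤n
    ∨≤+ false y = ≤-refl
  ts≤r : t * s ≤ r
  ts≤r = ≤-trans (≤-reflexive (*-distribˡ-sum t (⟦_⟧ ∘ S))) (sum-mono-≤ row)
    where
    row : ∀ a → t * ⟦ S a ⟧ ≤ ♯ (edge a)
    row a with S a in Sa
    ... | true  = ≤-trans (≤-reflexive (*-identityʳ t)) (dense a Sa)
    ... | false = ≤-trans (≤-reflexive (*-zeroʳ t)) z≤n
  gaps : ∀ r → t * s ≤ r → 3 ^ r * (2 * (2 * κ)) ^ s ≤ 4 ^ r
  gaps r ts≤r with m≤n⇒∃[o]m+o≡n ts≤r
  ... | e , refl = begin
    3 ^ (t * s + e) * z ^ s        ≡⟨ cong (_* z ^ s) (^-distribˡ-+-* 3 (t * s) e) ⟩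
    3 ^ (t * s) * 3 ^ e * z ^ s    ≡⟨ cong (λ x → x * 3 ^ e * z ^ s) (^-*-assoc 3 t s) ⟨
    (3 ^ t) ^ s * 3 ^ e * z ^ s    ≡⟨ *-swapʳ ((3 ^ t) ^ s) (3 ^ e) (z ^ s) ⟩
    (3 ^ t) ^ s * z ^ s * 3 ^ e    ≡⟨ cong (_* 3 ^ e) (^-distribʳ-* (3 ^ t) z s) ⟨
    (3 ^ t * z) ^ s * 3 ^ e        ≤⟨ *-mono-≤ (^-monoˡ-≤ s gap) (^-monoˡ-≤ e (n≤1+n 3)) ⟩
    (4 ^ t) ^ s * 4 ^ e            ≡⟨ cong (_* 4 ^ e) (^-*-assoc 4 t s) ⟩
    4 ^ (t * s) * 4 ^ e            ≡⟨ ^-distribˡ-+-* 4 (t * s) e ⟨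
    4 ^ (t * s + e)                ∎
    where
    z = 2 * (2 * κ)
  lemma : ∀ a b c d e → a * b * c * d * e ≡ d * b * (c * (a * e))
  lemma = solve-∀
  acyclic⇒potential : ∀ o → acyclic edge o ≡ true →
    Σ (Fin N → ℕ) λ π → ∀ a b → edge a b ≡ true → PointsAlong (lookup o (combine a b)) (π a) (π b)
  acyclic⇒potential o acyc with potential-or-cycle (orient edge o)
  ... | inj₁ (π , dec) = π , along
    where
    along : ∀ a b → edge a b ≡ true → PointsAlong (lookup o (combine a b)) (π a) (π b)
    along a b ab with lookup o (combine a b) in bit
    ... | suc _ = dec a b (forward a b ab (cong up bit))
      where
      forward : ∀ a b → edge a b ≡ true → up (lookup o (combine a b)) ≡ true → orient edge o a b ≡ true
      forward a b ab bit rewrite ab | bit = refl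
    ... | zero  = dec b a (backward a b ab (cong up bit))
      where
      backward : ∀ a b → edge a b ≡ true → up (lookup o (combine a b)) ≡ false → orient edge o b a ≡ true
      backward a b ab bit rewrite ab | bit = ∨-zeroʳ _
  acyclic⇒potential o () | inj₂ _

-- Throughout, ψ picks a colour from each list on B, ℓ assigns minterms, χ picks colours for the
-- stuck vertices, and o holds the orientation bits.
module UnionBound {N κ′ m′ M : ℕ} (adj : Fin N → Fin N → Bool) (γ : Gadget (suc κ′) (suc κ′) (suc m′) M)
  (A B : Fin N → Bool) (c : Fin N → Fin M) (t h : ℕ)
  (frequent : ∀ v → A v ≡ true → ∀ i → suc κ′ * t ≤ ♯ (λ u → adj v u ∧ (B u ∧ ⌊ c u ≟ i ⌋)))
  (large : 2 * suc m′ * (h * ♯ B + 1) ≤ ♯ A)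
  (gap : 3 ^ t * (2 * (2 * suc κ′)) ≤ 4 ^ t) (2κ≤2^h : 2 * suc κ′ ≤ 2 ^ h) where
  open ≤-Reasoning
  κ = suc κ′
  m = suc m′
  E = N * N
  b = ♯ B

  colB : Vec (Fin κ) N → Fin N → Fin (width γ)
  colB ψ u = maxterm γ (c u) (lookup ψ u)
  sameNeighbour : Vec (Fin κ) N → Fin N → Fin (width γ) → Fin N → Bool
  sameNeighbour ψ a x u = adj a u ∧ (B u ∧ ⌊ colB ψ u ≟ x ⌋)
  crowded? : ∀ ψ a i → Dec (∀ j → t ≤ ♯ (sameNeighbour ψ a (minterm γ i j)))
  crowded? ψ a i = all? (λ j → t ≤? ♯ (sameNeighbour ψ a (minterm γ i j)))
  -- Looks only at the minterm given to `a` itself, so for fixed ψ being stuck is independent over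
  -- the vertices.
  stuckOn : Vec (Fin κ) N → Fin N → Fin m → Bool
  stuckOn ψ a i = A a ∧ ⌊ crowded? ψ a i ⌋
  stuck : Vec (Fin κ) N → Vec (Fin m) N → Fin N → Bool
  stuck ψ ℓ a = stuckOn ψ a (lookup ℓ a)
  conflict : Vec (Fin κ) N → Vec (Fin m) N → Vec (Fin κ) N → Fin N → Fin N → Bool
  conflict ψ ℓ χ a u = stuck ψ ℓ a ∧ sameNeighbour ψ a (minterm γ (lookup ℓ a) (lookup χ a)) u

  some-list-stuck : ∀ ψ a → A a ≡ true → ∃ λ i → stuckOn ψ a i ≡ true
  some-list-stuck ψ a Aa with dichotomy γ (λ x → ⌊ t ≤? ♯ (sameNeighbour ψ a x) ⌋)
  ... | inj₁ (i , many) = i , true-∧ Aa (⌊⌋-true (crowded? ψ a i) λ j → true-⌊⌋ (t ≤? _) (many j))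
  -- The neighbours of type i draw from the κ colours of maxterm i; were each colour rare, there
  -- would be fewer than κ t of them.
  ... | inj₂ (i , few) = contradiction (begin-strict
      κ * t                                                          ≤⟨ frequent a Aa i ⟩
      ♯ (λ u → adj a u ∧ (B u ∧ ⌊ c u ≟ i ⌋))                         ≤⟨ sum-mono-≤ split ⟩
      sum (λ u → sum (λ j → ⟦ sameNeighbour ψ a (maxterm γ i j) u ⟧))   ≡⟨ ∑-comm (λ u j → ⟦ sameNeighbour ψ a (maxterm γ i j) u ⟧) ⟩
      sum (λ j → ♯ (sameNeighbour ψ a (maxterm γ i j)))                 <⟨ sum-<-const (<⇒≤ ∘ rare) zero (rare zero) ⟩
      κ * t                                                          ∎) (<-irrefl refl)
    where
    rare : ∀ j → ♯ (sameNeighbour ψ a (maxterm γ i j)) < t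
    rare j with t ≤? ♯ (sameNeighbour ψ a (maxterm γ i j)) | few j
    ... | no ¬t≤ | _ = ≰⇒> ¬t≤
    split : ∀ u → ⟦ adj a u ∧ (B u ∧ ⌊ c u ≟ i ⌋) ⟧ ≤ sum (λ j → ⟦ sameNeighbour ψ a (maxterm γ i j) u ⟧)
    split u with adj a u | B u | c u ≟ i
    ... | true  | true  | yes refl = ≤-trans (≤-reflexive (cong ⟦_⟧ (sym (⌊⌋-true (colB ψ u ≟ colB ψ u) refl))))
      (term≤sum (λ j → ⟦ ⌊ colB ψ u ≟ maxterm γ i j ⌋ ⟧) (lookup ψ u))
    ... | true  | true  | no  _    = z≤n
    ... | true  | false | _        = z≤n
    ... | false | _     | _        = z≤n

  supported : (Fin N → Bool) → Vec (Fin κ) N → ℕ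
  supported S v = product (λ i → ⟦ supportedIn S v i ⟧)

  X : Vec (Fin κ) N → Vec (Fin m) N → Vec (Fin κ) N → ℕ
  X ψ ℓ χ = satisfying (acyclic (conflict ψ ℓ χ))
  Y : Vec (Fin κ) N → Vec (Fin m) N → ℕ
  Y ψ ℓ = ∑ᵛ N (λ χ → supported (stuck ψ ℓ) χ * X ψ ℓ χ)

  X≤ : ∀ ψ ℓ χ → X ψ ℓ χ * (2 * κ) ^ ♯ (stuck ψ ℓ) ≤ 2 ^ E * 2 ^ b
  X≤ ψ ℓ χ = few-acyclic (conflict ψ ℓ χ) (stuck ψ ℓ) B κ t inSB dense gap
    where
    inSB : ∀ a u → conflict ψ ℓ χ a u ≡ true → stuck ψ ℓ a ≡ true × B u ≡ true
    inSB a u e with ∧-true {stuck ψ ℓ a} e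
    ... | Sa , e′ with ∧-true {adj a u} e′
    ...   | _ , e″ = Sa , proj₁ (∧-true {B u} e″)
    dense : ∀ a → stuck ψ ℓ a ≡ true → t ≤ ♯ (conflict ψ ℓ χ a)
    dense a Sa = ≤-trans (true-⌊⌋ (crowded? ψ a (lookup ℓ a)) (proj₂ (∧-true {A a} Sa)) (lookup χ a))
      (♯-mono {p = sameNeighbour ψ a (minterm γ (lookup ℓ a) (lookup χ a))} λ u → true-∧ Sa)

  -- The κ^s choices of χ use up the κ^s inside (2κ)^s, leaving a gain of 2 per stuck vertex.
  Y≤ : ∀ ψ ℓ → Y ψ ℓ * 2 ^ ♯ (stuck ψ ℓ) ≤ 2 ^ E * 2 ^ b
  Y≤ ψ ℓ = *-cancelʳ-≤ _ _ (κ ^ s) ⦃ m^n≢0 κ s ⦄ (begin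
    Y ψ ℓ * 2 ^ s * κ ^ s
      ≡⟨ *-assoc (Y ψ ℓ) (2 ^ s) (κ ^ s) ⟩
    Y ψ ℓ * (2 ^ s * κ ^ s)
      ≡⟨ cong (Y ψ ℓ *_) (^-distribʳ-* 2 κ s) ⟨
    Y ψ ℓ * (2 * κ) ^ s
      ≡⟨ ∑ᵛ-*ʳ N ((2 * κ) ^ s) (λ χ → supported (stuck ψ ℓ) χ * X ψ ℓ χ) ⟩
    ∑ᵛ N (λ χ → supported (stuck ψ ℓ) χ * X ψ ℓ χ * (2 * κ) ^ s)
      ≤⟨ ∑ᵛ-mono-≤ N (λ χ → ≤-trans (≤-reflexive (*-assoc (supported (stuck ψ ℓ) χ) (X ψ ℓ χ) _)) (*-monoʳ-≤ (supported (stuck ψ ℓ) χ) (X≤ ψ ℓ χ))) ⟩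
    ∑ᵛ N (λ χ → supported (stuck ψ ℓ) χ * (2 ^ E * 2 ^ b))
      ≡⟨ ∑ᵛ-*ʳ N (2 ^ E * 2 ^ b) (supported (stuck ψ ℓ)) ⟨
    ∑ᵛ N (supported (stuck ψ ℓ)) * (2 ^ E * 2 ^ b)
      ≡⟨ cong (_* (2 ^ E * 2 ^ b)) (∑ᵛ-supported κ′ (stuck ψ ℓ)) ⟩
    κ ^ s * (2 ^ E * 2 ^ b)
      ≡⟨ *-comm (κ ^ s) _ ⟩
    2 ^ E * 2 ^ b * κ ^ s ∎)
    where s = ♯ (stuck ψ ℓ)

  free : Vec (Fin κ) N → Fin N → Fin m → ℕ
  free ψ a i = if stuckOn ψ a i then 1 else 2

  ∑free : ∀ ψ a → sum (free ψ a) ≤ (if A a then pred (2 * m) else 2 * m)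
  ∑free ψ a with A a in Aa
  ... | true  = let i , st = some-list-stuck ψ a Aa in s≤s⁻¹ (subst (sum (λ i → if ⌊ crowded? ψ a i ⌋ then 1 else 2) <_) (*-comm m 2)
    (sum-<-const {m} (λ i → ≤2 ⌊ crowded? ψ a i ⌋) i
      (≤-reflexive (cong (λ x → suc (if x then 1 else 2)) (proj₂ (∧-true {A a} st))))))
    where
    ≤2 : ∀ x → (if x then 1 else 2) ≤ 2
    ≤2 true  = s≤s z≤n
    ≤2 false = ≤-refl
  ... | false = ≤-reflexive (trans (sum-const m 2) (*-comm m 2))

  -- The average of 2^(-#stuck) over the minterms factorises. At each vertex of A some minterm is
  -- stuck, so its factor is at most (2m - 1)/(2m).
  ∑Y : ∀ ψ → ∑ᵛ N (Y ψ) * 2 ^ (h * b + 1) ≤ 2 ^ E * 2 ^ b * m ^ N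
  ∑Y ψ = *-cancelʳ-≤ _ _ (2 ^ N) ⦃ m^n≢0 2 N ⦄ (begin
    ∑ᵛ N (Y ψ) * 2 ^ (h * b + 1) * 2 ^ N
      ≡⟨ *-swapʳ (∑ᵛ N (Y ψ)) (2 ^ (h * b + 1)) (2 ^ N) ⟩
    ∑ᵛ N (Y ψ) * 2 ^ N * 2 ^ (h * b + 1)
      ≡⟨ cong (_* 2 ^ (h * b + 1)) (∑ᵛ-*ʳ N (2 ^ N) (Y ψ)) ⟩
    ∑ᵛ N (λ ℓ → Y ψ ℓ * 2 ^ N) * 2 ^ (h * b + 1)
      ≤⟨ *-monoˡ-≤ (2 ^ (h * b + 1)) (∑ᵛ-mono-≤ N each) ⟩
    ∑ᵛ N (λ ℓ → 2 ^ E * 2 ^ b * product (λ a → free ψ a (lookup ℓ a))) * 2 ^ (h * b + 1)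
      ≡⟨ cong (_* 2 ^ (h * b + 1)) (∑ᵛ-*ˡ N (2 ^ E * 2 ^ b) (λ ℓ → product (λ a → free ψ a (lookup ℓ a)))) ⟨
    2 ^ E * 2 ^ b * ∑ᵛ N (λ ℓ → product (λ a → free ψ a (lookup ℓ a))) * 2 ^ (h * b + 1)
      ≡⟨ cong (λ x → 2 ^ E * 2 ^ b * x * 2 ^ (h * b + 1)) (∑ᵛ-product N (free ψ)) ⟩
    2 ^ E * 2 ^ b * product (λ a → sum (free ψ a)) * 2 ^ (h * b + 1)
      ≡⟨ *-assoc (2 ^ E * 2 ^ b) (product (λ a → sum (free ψ a))) _ ⟩
    2 ^ E * 2 ^ b * (product (λ a → sum (free ψ a)) * 2 ^ (h * b + 1))
      ≤⟨ *-monoʳ-≤ (2 ^ E * 2 ^ b) (product-gap (pred (2 * m)) (h * b + 1) A _ (∑free ψ) large) ⟩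
    2 ^ E * 2 ^ b * (2 * m) ^ N
      ≡⟨ cong (2 ^ E * 2 ^ b *_) (trans (^-distribʳ-* 2 m N) (*-comm (2 ^ N) (m ^ N))) ⟩
    2 ^ E * 2 ^ b * (m ^ N * 2 ^ N)
      ≡⟨ *-assoc (2 ^ E * 2 ^ b) (m ^ N) (2 ^ N) ⟨
    2 ^ E * 2 ^ b * m ^ N * 2 ^ N ∎)
    where
    each : ∀ ℓ → Y ψ ℓ * 2 ^ N ≤ 2 ^ E * 2 ^ b * product (λ a → free ψ a (lookup ℓ a))
    each ℓ = begin
      Y ψ ℓ * 2 ^ N                ≡⟨ cong (Y ψ ℓ *_) (trans (*-comm (2 ^ ♯ (stuck ψ ℓ)) Π) (product-half (stuck ψ ℓ))) ⟨
      Y ψ ℓ * (2 ^ ♯ (stuck ψ ℓ) * Π) ≡⟨ *-assoc (Y ψ ℓ) _ Π ⟨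
      Y ψ ℓ * 2 ^ ♯ (stuck ψ ℓ) * Π ≤⟨ *-monoˡ-≤ Π (Y≤ ψ ℓ) ⟩
      2 ^ E * 2 ^ b * Π ∎
      where Π = product (λ a → free ψ a (lookup ℓ a))

  Z : ℕ
  Z = ∑ᵛ N (λ ψ → supported B ψ * ∑ᵛ N (Y ψ))

  -- The κ^b colourings of B and the 2^b from the acyclicity bound are absorbed by 2^(h b); the
  -- `+ 1` in the exponent leaves the factor 2.
  Z≤ : Z * 2 ≤ m ^ N * 2 ^ E
  Z≤ = *-cancelʳ-≤ _ _ ((2 ^ h) ^ b) ⦃ m^n≢0 (2 ^ h) b ⦃ m^n≢0 2 h ⦄ ⦄ (begin
    Z * 2 * (2 ^ h) ^ b
      ≡⟨ cong (Z * 2 *_) (^-*-assoc 2 h b) ⟩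
    Z * 2 * 2 ^ (h * b)
      ≡⟨ lemma₁ Z (2 ^ (h * b)) ⟩
    Z * (2 ^ (h * b) * 2 ^ 1)
      ≡⟨ cong (Z *_) (^-distribˡ-+-* 2 (h * b) 1) ⟨
    Z * 2 ^ (h * b + 1)
      ≡⟨ ∑ᵛ-*ʳ N (2 ^ (h * b + 1)) (λ ψ → supported B ψ * ∑ᵛ N (Y ψ)) ⟩
    ∑ᵛ N (λ ψ → supported B ψ * ∑ᵛ N (Y ψ) * 2 ^ (h * b + 1))
      ≤⟨ ∑ᵛ-mono-≤ N (λ ψ → ≤-trans (≤-reflexive (*-assoc (supported B ψ) (∑ᵛ N (Y ψ)) _)) (*-monoʳ-≤ (supported B ψ) (∑Y ψ))) ⟩
    ∑ᵛ N (λ ψ → supported B ψ * (2 ^ E * 2 ^ b * m ^ N))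
      ≡⟨ ∑ᵛ-*ʳ N (2 ^ E * 2 ^ b * m ^ N) (supported B) ⟨
    ∑ᵛ N (supported B) * (2 ^ E * 2 ^ b * m ^ N)
      ≡⟨ cong (_* (2 ^ E * 2 ^ b * m ^ N)) (∑ᵛ-supported κ′ B) ⟩
    κ ^ b * (2 ^ E * 2 ^ b * m ^ N)
      ≡⟨ lemma₂ (κ ^ b) (2 ^ E) (2 ^ b) (m ^ N) ⟩
    m ^ N * 2 ^ E * (2 ^ b * κ ^ b)
      ≡⟨ cong (m ^ N * 2 ^ E *_) (^-distribʳ-* 2 κ b) ⟨
    m ^ N * 2 ^ E * (2 * κ) ^ b
      ≤⟨ *-monoʳ-≤ (m ^ N * 2 ^ E) (^-monoˡ-≤ b 2κ≤2^h) ⟩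
    m ^ N * 2 ^ E * (2 ^ h) ^ b ∎)
    where
    lemma₁ : ∀ z x → z * 2 * x ≡ z * (x * 2)
    lemma₁ = solve-∀
    lemma₂ : ∀ a b c d → a * (b * c * d) ≡ d * b * (c * a)
    lemma₂ = solve-∀

  cost : Vec (Fin m) N → Vec (Fin 2) E → Vec (Fin κ) N → Vec (Fin κ) N → ℕ
  cost ℓ o ψ χ = supported B ψ * (supported (stuck ψ ℓ) χ * ⟦ acyclic (conflict ψ ℓ χ) o ⟧)
  total : Vec (Fin m) N → Vec (Fin 2) E → ℕ
  total ℓ o = ∑ᵛ N (λ ψ → ∑ᵛ N (cost ℓ o ψ))

  ∑total : ∑ᵛ N (λ ℓ → ∑ᵛ E (total ℓ)) ≡ Z
  ∑total = begin-equality
    ∑ᵛ N (λ ℓ → ∑ᵛ E (λ o → ∑ᵛ N (λ ψ → ∑ᵛ N (cost ℓ o ψ))))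
      ≡⟨ ∑ᵛ-cong N (λ ℓ → ∑ᵛ-comm E N (λ o ψ → ∑ᵛ N (cost ℓ o ψ))) ⟩
    ∑ᵛ N (λ ℓ → ∑ᵛ N (λ ψ → ∑ᵛ E (λ o → ∑ᵛ N (cost ℓ o ψ))))
      ≡⟨ ∑ᵛ-comm N N (λ ℓ ψ → ∑ᵛ E (λ o → ∑ᵛ N (cost ℓ o ψ))) ⟩
    ∑ᵛ N (λ ψ → ∑ᵛ N (λ ℓ → ∑ᵛ E (λ o → ∑ᵛ N (cost ℓ o ψ))))
      ≡⟨ ∑ᵛ-cong N (λ ψ → ∑ᵛ-cong N (λ ℓ → inner ψ ℓ)) ⟩
    ∑ᵛ N (λ ψ → ∑ᵛ N (λ ℓ → supported B ψ * Y ψ ℓ))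
      ≡⟨ ∑ᵛ-cong N (λ ψ → ∑ᵛ-*ˡ N (supported B ψ) (Y ψ)) ⟨
    Z ∎
    where
    inner : ∀ ψ ℓ → ∑ᵛ E (λ o → ∑ᵛ N (cost ℓ o ψ)) ≡ supported B ψ * Y ψ ℓ
    inner ψ ℓ = begin-equality
      ∑ᵛ E (λ o → ∑ᵛ N (cost ℓ o ψ))
        ≡⟨ ∑ᵛ-comm E N (λ o → cost ℓ o ψ) ⟩
      ∑ᵛ N (λ χ → ∑ᵛ E (λ o → cost ℓ o ψ χ))
        ≡⟨ ∑ᵛ-cong N (λ χ → trans (sym (∑ᵛ-*ˡ E (supported B ψ) (λ o → supported (stuck ψ ℓ) χ * ⟦ acyclic (conflict ψ ℓ χ) o ⟧)))
             (cong (supported B ψ *_) (sym (∑ᵛ-*ˡ E (supported (stuck ψ ℓ) χ) (⟦_⟧ ∘ acyclic (conflict ψ ℓ χ)))))) ⟩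
      ∑ᵛ N (λ χ → supported B ψ * (supported (stuck ψ ℓ) χ * X ψ ℓ χ))
        ≡⟨ ∑ᵛ-*ˡ N (supported B ψ) (λ χ → supported (stuck ψ ℓ) χ * X ψ ℓ χ) ⟨
      supported B ψ * Y ψ ℓ ∎

  product-⟦⟧ : ∀ {n} (p : Fin n → Bool) → (∀ i → p i ≡ true) → product (⟦_⟧ ∘ p) ≡ 1
  product-⟦⟧ {zero}  p all = refl
  product-⟦⟧ {suc n} p all = cong₂ _*_ (cong ⟦_⟧ (all zero)) (product-⟦⟧ (p ∘ suc) (all ∘ suc))

  -- On average over ℓ and o at most 1/2 of a choice (ψ, χ) is acyclic, so some pair has none at all
  -- and defeats every colouring at once.
  no-acyclic : Σ (Vec (Fin m) N) λ ℓ → Σ (Vec (Fin 2) E) λ o → ∀ ψ χ →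
    (∀ v → supportedIn B ψ v ≡ true) → (∀ v → supportedIn (stuck ψ ℓ) χ v ≡ true) →
    Cycle (orient (conflict ψ ℓ χ) o)
  no-acyclic = chooseℓ (∑ᵛ-below-average N (λ ℓ → ∑ᵛ E (total ℓ)) (2 ^ E) (subst (_< m ^ N * 2 ^ E) (sym ∑total) (Z< Z≤)))
    where
    Z< : ∀ {z w} → z * 2 ≤ w → {{NonZero w}} → z < w
    Z< {zero}  {suc w} _ = s≤s z≤n
    Z< {suc z} 2z≤w = ≤-trans (s≤s (s≤s (≤-trans (m≤m+n z z) (≤-reflexive (lemma z))))) 2z≤w
      where
      lemma : ∀ z → z + z ≡ z * 2
      lemma = solve-∀
    instance
      m^N*2^E≢0 : NonZero (m ^ N * 2 ^ E)
      m^N*2^E≢0 = m*n≢0 (m ^ N) (2 ^ E) ⦃ m^n≢0 m N ⦄ ⦃ m^n≢0 2 E ⦄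
    cyclic : ∀ ℓ o → total ℓ o < 1 → ∀ ψ χ →
      (∀ v → supportedIn B ψ v ≡ true) → (∀ v → supportedIn (stuck ψ ℓ) χ v ≡ true) → Cycle (orient (conflict ψ ℓ χ) o)
    cyclic ℓ o none ψ χ supB supS with potential-or-cycle (orient (conflict ψ ℓ χ) o) in eq
    ... | inj₂ cycle = cycle
    ... | inj₁ _     = contradiction (begin-strict
      1                                ≡⟨ cong₂ _*_ (product-⟦⟧ (supportedIn B ψ) supB) (cong₂ _*_ (product-⟦⟧ (supportedIn (stuck ψ ℓ) χ) supS) acyc) ⟨
      cost ℓ o ψ χ                     ≤⟨ term≤∑ᵛ N (cost ℓ o ψ) χ ⟩
      ∑ᵛ N (cost ℓ o ψ)                ≤⟨ term≤∑ᵛ N (λ ψ → ∑ᵛ N (cost ℓ o ψ)) ψ ⟩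
      total ℓ o                        <⟨ none ⟩
      1                                ∎) (<-irrefl refl)
      where
      acyc : ⟦ acyclic (conflict ψ ℓ χ) o ⟧ ≡ 1
      acyc rewrite eq = refl
    chooseℓ : (∃ λ ℓ → ∑ᵛ E (total ℓ) < 2 ^ E) → _
    chooseℓ (ℓ , low) = chooseo (∑ᵛ-below-average E (total ℓ) 1 (subst (∑ᵛ E (total ℓ) <_) (sym (*-identityʳ (2 ^ E))) low))
      where
      chooseo : (∃ λ o → total ℓ o < 1) → _
      chooseo (o , none) = ℓ , o , cyclic ℓ o none

-- Orientations and lists without dicolouring

degree≡♯ : ∀ {n} (G : Graph n) v → degree G v ≡ ♯ (adj G v)
degree≡♯ G v = count (adj G v) id
  where
  count : ∀ {n k} (p : Fin k → Bool) (f : Fin n → Fin k) → length (filterᵇ p (List.tabulate f)) ≡ ♯ (p ∘ f)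
  count {zero}  p f = refl
  count {suc n} p f with p (f zero)
  ... | true  = cong suc (count p (f ∘ suc))
  ... | false = count p (f ∘ suc)

-- Edges between B and its complement follow the bit stored at (outside, inside), one bit per edge;
-- all others follow the vertex numbering.
forward : ∀ {N} → (Fin N → Bool) → Vec (Fin 2) (N * N) → Fin N → Fin N → Bool
forward B o u v with B u | B v
... | false | true  = up (lookup o (combine u v))
... | true  | false = not (up (lookup o (combine v u)))
... | _     | _     = ⌊ toℕ u <? toℕ v ⌋

orientation : ∀ {N} (G : Graph N) → (Fin N → Bool) → Vec (Fin 2) (N * N) → Orientation G
orientation G B o = record
  { arc     = λ u v → adj G u v ≡ true × forward B o u v ≡ true
  ; arc⇒adj = λ u v → proj₁
  ; adj⇒arc = λ u v uv → total u v uv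
  ; antisym = λ u v uv vu → asymmetric u v (proj₂ uv) (proj₂ vu)
  }
  where
  asymmetric : ∀ u v → forward B o u v ≡ true → forward B o v u ≡ true → _
  asymmetric u v uv vu with B u | B v
  ... | false | true  = contradiction (trans (sym uv) (true-not vu)) λ ()
  ... | true  | false = contradiction (trans (sym vu) (true-not uv)) λ ()
  ... | true  | true  = <-asym (true-⌊⌋ (toℕ u <? toℕ v) uv) (true-⌊⌋ (toℕ v <? toℕ u) vu)
  ... | false | false = <-asym (true-⌊⌋ (toℕ u <? toℕ v) uv) (true-⌊⌋ (toℕ v <? toℕ u) vu)
  either : ∀ x → x ≡ true ⊎ not x ≡ true
  either true  = inj₁ refl
  either false = inj₂ refl
  not-either : ∀ x → not x ≡ true ⊎ x ≡ true
  not-either true  = inj₂ refl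
  not-either false = inj₁ refl
  ordered : ∀ u v → adj G u v ≡ true → ⌊ toℕ u <? toℕ v ⌋ ≡ true ⊎ ⌊ toℕ v <? toℕ u ⌋ ≡ true
  ordered u v uv with <-cmp (toℕ u) (toℕ v)
  ... | tri< u<v _ _ = inj₁ (⌊⌋-true (toℕ u <? toℕ v) u<v)
  ... | tri> _ _ v<u = inj₂ (⌊⌋-true (toℕ v <? toℕ u) v<u)
  ... | tri≈ _ u≡v _ with toℕ-injective u≡v
  ...   | refl = contradiction (trans (sym uv) (irrefl G u)) λ ()
  comparable : ∀ u v → adj G u v ≡ true → forward B o u v ≡ true ⊎ forward B o v u ≡ true
  comparable u v uv with B u | B v
  ... | false | true  = either _
  ... | true  | false = not-either _
  ... | true  | true  = ordered u v uv
  ... | false | false = ordered u v uv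
  total : ∀ u v → adj G u v ≡ true →
    (adj G u v ≡ true × forward B o u v ≡ true) ⊎ (adj G v u ≡ true × forward B o v u ≡ true)
  total u v uv = Sum.map (uv ,_) (trans (Defs.sym G v u) uv ,_) (comparable u v uv)

forward-AB : ∀ {N} {B : Fin N → Bool} {o} u v → B u ≡ false → B v ≡ true → forward B o u v ≡ up (lookup o (combine u v))
forward-AB {B = B} u v Bu Bv rewrite Bu | Bv = refl

forward-BA : ∀ {N} {B : Fin N → Bool} {o} u v → B u ≡ true → B v ≡ false → forward B o u v ≡ not (up (lookup o (combine v u)))
forward-BA {B = B} u v Bu Bv rewrite Bu | Bv = refl

∨-true : ∀ {a b} → a ∨ b ≡ true → a ≡ true ⊎ b ≡ true
∨-true {true}  _ = inj₁ refl
∨-true {false} e = inj₂ e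

constant-along : ∀ {l} (f : Fin (suc l) → ℕ) → (∀ i → f (inject₁ i) ≡ f (suc i)) → ∀ i → f i ≡ f zero
constant-along f step zero = refl
constant-along {suc l} f step (suc i) = trans (constant-along (f ∘ suc) (step ∘ suc) i) (sym (step zero))

select : ∀ {N κ′} (S : Fin N → Bool) (Q : Fin N → Fin (suc κ′) → Set) → (∀ v → S v ≡ true → ∃ (Q v)) →
  Σ (Vec (Fin (suc κ′)) N) λ ψ → (∀ v → supportedIn S ψ v ≡ true) × (∀ v → S v ≡ true → Q v (lookup ψ v))
select {N} {κ′} S Q choice = tabulate f , supp , spec
  where
  pick : ∀ v → Σ (Fin (suc κ′)) λ j → (S v ∨ ⌊ j ≟ zero ⌋ ≡ true) × (S v ≡ true → Q v j)
  pick v with S v in Sv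
  ... | true  = let j , Qj = choice v Sv in j , refl , λ _ → Qj
  -- Off `S` the value must be zero, since `supportedIn` counts only such vectors.
  ... | false = zero , refl , λ ()
  f = proj₁ ∘ pick
  supp : ∀ v → supportedIn S (tabulate f) v ≡ true
  supp v = subst (λ j → S v ∨ ⌊ j ≟ zero ⌋ ≡ true) (sym (lookup∘tabulate f v)) (proj₁ (proj₂ (pick v)))
  spec : ∀ v → S v ≡ true → Q v (lookup (tabulate f) v)
  spec v Sv = subst (Q v) (sym (lookup∘tabulate f v)) (proj₂ (proj₂ (pick v)) Sv)

palette : ∀ {a w} → (Fin a → Fin w) → List ℕ
palette f = List.tabulate (suc ∘ toℕ ∘ f)

palette-valid : ∀ {a w k} (f : Fin a → Fin w) → Injective _≡_ _≡_ f → k ≤ a →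
  Unique (palette f) × k ≤ length (palette f) × All (1 ≤_) (palette f)
palette-valid f inj k≤a = Unique.tabulate⁺ (inj ∘ toℕ-injective ∘ suc-injective) ,
  ≤-trans k≤a (≤-reflexive (sym (length-tabulate (suc ∘ toℕ ∘ f)))) , All.tabulate⁺ (λ _ → s≤s z≤n)

threshold multiplicity : ℕ → ℕ
threshold κ    = 3 * (κ + 2)
multiplicity κ = κ * threshold κ

-- Three edges gain a factor 64/27 > 2, so 3(κ + 2) of them gain 2^(κ+2) ≥ 4κ.
threshold-gap : ∀ κ → 3 ^ threshold κ * (2 * (2 * κ)) ≤ 4 ^ threshold κ
threshold-gap κ = begin
  3 ^ (3 * (κ + 2)) * (2 * (2 * κ))    ≡⟨ cong₂ _*_ (sym (^-*-assoc 3 3 (κ + 2))) (lemma κ) ⟩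
  27 ^ (κ + 2) * (κ * 4)               ≤⟨ *-monoʳ-≤ (27 ^ (κ + 2)) (*-monoˡ-≤ 4 (n≤2^n κ)) ⟩
  27 ^ (κ + 2) * (2 ^ κ * 2 ^ 2)       ≡⟨ cong (27 ^ (κ + 2) *_) (^-distribˡ-+-* 2 κ 2) ⟨
  27 ^ (κ + 2) * 2 ^ (κ + 2)           ≡⟨ ^-distribʳ-* 27 2 (κ + 2) ⟨
  54 ^ (κ + 2)                         ≤⟨ ^-monoˡ-≤ (κ + 2) (m≤m+n 54 10) ⟩
  64 ^ (κ + 2)                         ≡⟨ ^-*-assoc 4 3 (κ + 2) ⟩
  4 ^ (3 * (κ + 2))                    ∎
  where
  open ≤-Reasoning
  lemma : ∀ κ → 2 * (2 * κ) ≡ κ * 4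
  lemma = solve-∀

2κ≤2^[1+κ] : ∀ κ → 2 * κ ≤ 2 ^ suc κ
2κ≤2^[1+κ] κ = *-monoʳ-≤ 2 (n≤2^n κ)

-- One assignment serves all k ≤ κ, because a k-list may be longer than k.
UncolourableLists : ∀ {N} {G : Graph N} → Orientation G → ℕ → Set
UncolourableLists {N} D κ = Σ (Fin N → List ℕ) λ L →
  (∀ k → k ≤ κ → IsListAssignment k L) × (∀ φ → ¬ IsLDicolouring D L φ)

module Lists {N κ′ m′ M} (G : Graph N) (γ : Gadget (suc κ′) (suc κ′) (suc m′) M)
  (A B : Fin N → Bool) (c : Fin N → Fin M)
  (disjoint : ∀ v → A v ≡ true → B v ≡ false)
  (frequent : ∀ v → A v ≡ true → ∀ i → multiplicity (suc κ′) ≤ ♯ (λ u → adj G v u ∧ (B u ∧ ⌊ c u ≟ i ⌋)))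
  (large : 2 * suc m′ * (suc (suc κ′) * ♯ B + 1) ≤ ♯ A) where
  open UnionBound (adj G) γ A B c (threshold (suc κ′)) (suc (suc κ′)) frequent large
    (threshold-gap (suc κ′)) (2κ≤2^[1+κ] (suc κ′))

  module Fixed (ℓ : Vec (Fin m) N) (o : Vec (Fin 2) (N * N))
    (cyclic : ∀ ψ χ → (∀ v → supportedIn B ψ v ≡ true) → (∀ v → supportedIn (stuck ψ ℓ) χ v ≡ true) →
      Cycle (orient (conflict ψ ℓ χ) o)) where

    D : Orientation G
    D = orientation G B o

    L : Fin N → List ℕ
    L v = if B v then palette (maxterm γ (c v)) else palette (minterm γ (lookup ℓ v))

    L-valid : ∀ k → k ≤ κ → IsListAssignment k L
    L-valid k k≤κ v with B v
    ... | true  = palette-valid (maxterm γ (c v)) (maxterm-injective γ (c v)) k≤κ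
    ... | false = palette-valid (minterm γ (lookup ℓ v)) (minterm-injective γ (lookup ℓ v)) k≤κ

    stuck⇒¬B : ∀ {ψ} v → stuck ψ ℓ v ≡ true → B v ≡ false
    stuck⇒¬B v = disjoint v ∘ proj₁ ∘ ∧-true {A v}

    conflict⁻ : ∀ {ψ χ} a u → conflict ψ ℓ χ a u ≡ true →
      stuck ψ ℓ a ≡ true × B u ≡ true × adj G a u ≡ true × maxterm γ (c u) (lookup ψ u) ≡ minterm γ (lookup ℓ a) (lookup χ a)
    conflict⁻ {ψ} a u e = let Sa , e₁ = ∧-true {stuck ψ ℓ a} e
                              au , e₂ = ∧-true {adj G a u} e₁
                              Bu , e₃ = ∧-true {B u} e₂
                          in Sa , Bu , au , true-⌊⌋ (colB ψ u ≟ _) e₃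

    -- Conflicts join a stuck vertex outside B to a vertex of B, so `orient` and `forward` read the
    -- same bit.
    conflict⇒arc : ∀ {ψ χ} u v → orient (conflict ψ ℓ χ) o u v ≡ true →
      arc D u v × (conflict ψ ℓ χ u v ≡ true ⊎ conflict ψ ℓ χ v u ≡ true)
    conflict⇒arc {ψ} {χ} u v e with ∨-true {conflict ψ ℓ χ u v ∧ up (lookup o (combine u v))} e
    ... | inj₁ e₁ =
      let uv , bit = ∧-true {conflict ψ ℓ χ u v} e₁
          Su , Bv , adjuv , _ = conflict⁻ {ψ} {χ} u v uv
      in (adjuv , trans (forward-AB {B = B} {o} u v (stuck⇒¬B {ψ} u Su) Bv) bit) , inj₁ uv
    ... | inj₂ e₂ =
      let vu , bit = ∧-true {conflict ψ ℓ χ v u} e₂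
          Sv , Bu , adjvu , _ = conflict⁻ {ψ} {χ} v u vu
      in (trans (Defs.sym G u v) adjvu , trans (forward-BA {B = B} {o} u v Bu (stuck⇒¬B {ψ} v Sv)) bit) , inj₂ vu

    -- ψ is read off φ before χ, as the stuck set depends on ψ. Conflict edges are monochromatic
    -- under φ, hence so is the whole cycle.
    uncolourable : ∀ φ → ¬ IsLDicolouring D L φ
    uncolourable φ (φ∈L , acyc) = colour-B (select B B-coloured B-colour)
      where
      B-coloured : Fin N → Fin κ → Set
      B-coloured v j = φ v ≡ suc (toℕ (maxterm γ (c v) j))
      stuck-coloured : Fin N → Fin κ → Set
      stuck-coloured v j = φ v ≡ suc (toℕ (minterm γ (lookup ℓ v) j))
      B-colour : ∀ v → B v ≡ true → ∃ (B-coloured v)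
      B-colour v Bv = ∈-tabulate⁻ (subst (λ x → φ v ∈ (if x then palette (maxterm γ (c v)) else palette (minterm γ (lookup ℓ v)))) Bv (φ∈L v))
      stuck-colour : ∀ {ψ} v → stuck ψ ℓ v ≡ true → ∃ (stuck-coloured v)
      stuck-colour {ψ} v Sv = ∈-tabulate⁻ (subst (λ x → φ v ∈ (if x then palette (maxterm γ (c v)) else palette (minterm γ (lookup ℓ v)))) (stuck⇒¬B {ψ} v Sv) (φ∈L v))

      monochromatic : ∀ {ψ χ} → (∀ v → B v ≡ true → B-coloured v (lookup ψ v)) →
        (∀ v → stuck ψ ℓ v ≡ true → stuck-coloured v (lookup χ v)) → ∀ a u → conflict ψ ℓ χ a u ≡ true → φ a ≡ φ u
      monochromatic {ψ} {χ} colB colS a u au = let Sa , Bu , _ , same = conflict⁻ {ψ} {χ} a u au in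
        trans (colS a Sa) (trans (cong (suc ∘ toℕ) (sym same)) (sym (colB u Bu)))

      refute : ∀ {ψ χ} → (∀ a u → conflict ψ ℓ χ a u ≡ true → φ a ≡ φ u) → Cycle (orient (conflict ψ ℓ χ) o) → ⊥
      refute {ψ} {χ} mono (l , cyc , inj , arcs , closing) = acyc (φ (cyc zero)) (l , cyc , inj ,
        (λ i → proj₁ (conflict⇒arc {ψ} {χ} _ _ (arcs i))) , proj₁ (conflict⇒arc {ψ} {χ} _ _ closing) ,
        constant-along (φ ∘ cyc) λ i → same (proj₂ (conflict⇒arc {ψ} {χ} _ _ (arcs i))))
        where
        same : ∀ {u v} → conflict ψ ℓ χ u v ≡ true ⊎ conflict ψ ℓ χ v u ≡ true → φ u ≡ φ v
        same (inj₁ uv) = mono _ _ uv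
        same (inj₂ vu) = sym (mono _ _ vu)

      colour-stuck : ∀ ψ → (∀ v → supportedIn B ψ v ≡ true) → (∀ v → B v ≡ true → B-coloured v (lookup ψ v)) →
        (Σ (Vec (Fin κ) N) λ χ → (∀ v → supportedIn (stuck ψ ℓ) χ v ≡ true) × (∀ v → stuck ψ ℓ v ≡ true → stuck-coloured v (lookup χ v))) → ⊥
      colour-stuck ψ supB colB (χ , supS , colS) = refute {ψ} {χ} (monochromatic {ψ} {χ} colB colS) (cyclic ψ χ supB supS)

      colour-B : (Σ (Vec (Fin κ) N) λ ψ → (∀ v → supportedIn B ψ v ≡ true) × (∀ v → B v ≡ true → B-coloured v (lookup ψ v))) → ⊥
      colour-B (ψ , supB , colB) = colour-stuck ψ supB colB (select (stuck ψ ℓ) stuck-coloured (stuck-colour {ψ}))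

  uncolourable-lists : Σ (Orientation G) λ D → UncolourableLists D (suc κ′)
  uncolourable-lists = build no-acyclic
    where
    build : (Σ (Vec (Fin m) N) λ ℓ → Σ (Vec (Fin 2) (N * N)) λ o → ∀ ψ χ →
      (∀ v → supportedIn B ψ v ≡ true) → (∀ v → supportedIn (stuck ψ ℓ) χ v ≡ true) →
      Cycle (orient (conflict ψ ℓ χ) o)) → _
    build (ℓ , o , cyclic) = D , L , L-valid , uncolourable
      where open Fixed ℓ o cyclic

-- This is 2Qs from the sampling with Q′ = 16mh and h = κ + 1. That h exceeds log₂(2κ) affects only
-- the polynomial factor.
requiredDegree : (κ m M β : ℕ) → ℕ
requiredDegree κ m M β = 16 * (m * suc κ) * M * 2 * (multiplicity κ + β + 3)

gadget⇒uncolourable : ∀ {N κ m M} (G : Graph N) (β : ℕ) → Gadget κ κ m M → 1 ≤ κ → M ≤ 2 ^ β → Fin N →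
  (∀ v → requiredDegree κ m M β ≤ degree G v) → Σ (Orientation G) λ D → UncolourableLists D κ
-- Without minterms the full set would avoid a maxterm, which is nonempty as κ ≥ 1; the next case is
-- dual.
gadget⇒uncolourable {κ = suc κ′} {zero} {M} G β γ _ _ _ _ with dichotomy γ (λ _ → true)
... | inj₁ (() , _)
... | inj₂ (_ , h) = contradiction (h zero) λ ()
gadget⇒uncolourable {κ = suc κ′} {suc m′} {zero} G β γ _ _ _ _ with dichotomy γ (λ _ → false)
... | inj₁ (_ , h) = contradiction (h zero) λ ()
... | inj₂ (() , _)
gadget⇒uncolourable {N} {suc κ′} {suc m′} {suc M′} G β γ _ M≤2^β v₀ degree≥ =
  build (sampling (adj G) m (suc κ) (pred Q′) M′ (multiplicity κ) β (sym Q′≡) M≤2^β 1≤N 32m≤N ♯≥)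
  where
  open ≤-Reasoning
  κ = suc κ′
  m = suc m′
  M = suc M′
  Q′ = 16 * (m * suc κ)
  instance
    Q′≢0 : NonZero Q′
    Q′≢0 = m*n≢0 16 (m * suc κ)
  Q′≡ : suc (pred Q′) ≡ Q′
  Q′≡ = suc-pred Q′
  ♯≥ : ∀ v → suc (pred Q′) * M * 2 * (multiplicity κ + β + 3) ≤ ♯ (adj G v)
  ♯≥ v = ≤-trans (≤-reflexive (cong (λ q → q * M * 2 * (multiplicity κ + β + 3)) Q′≡))
           (≤-trans (degree≥ v) (≤-reflexive (degree≡♯ G v)))
  ♯≤N : ∀ {n} (p : Fin n → Bool) → ♯ p ≤ n
  ♯≤N {n} p = ≤-trans (sum-≤-const (⟦⟧≤1 ∘ p)) (≤-reflexive (*-identityʳ n))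
  32m≤N : 32 * m ≤ N
  32m≤N = begin
    32 * m                                      ≡⟨ lemma m 16 ⟩
    16 * (m * 1) * 1 * 2 * 1                    ≤⟨ *-mono-≤ {v = multiplicity κ + β + 3} (*-monoˡ-≤ 2 (*-mono-≤ {v = M} (*-monoʳ-≤ 16 (*-monoʳ-≤ m {y = suc κ} (s≤s z≤n))) (s≤s z≤n)))
                                                     (≤-trans (s≤s z≤n) (m≤n+m 3 (multiplicity κ + β))) ⟩
    requiredDegree κ m M β                      ≤⟨ ≤-trans (degree≥ v₀) (≤-reflexive (degree≡♯ G v₀)) ⟩
    ♯ (adj G v₀)                                ≤⟨ ♯≤N (adj G v₀) ⟩
    N                                           ∎
    where
    lemma : ∀ m c → (c * 2) * m ≡ c * (m * 1) * 1 * 2 * 1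
    lemma = solve-∀
  1≤N : 1 ≤ N
  1≤N = ≤-trans (≤-trans (s≤s z≤n) (m≤n*m m 32)) 32m≤N
  build : _ → _
  build (A , B , c , disjoint , frequent , large) = Lists.uncolourable-lists G γ A B c disjoint frequent large

-- Choice of parameters

dyadic-scale : ∀ a x → 1 ≤ a → a ≤ x → ∃ λ j → a * 2 ^ j ≤ x × x < a * 2 ^ suc j
dyadic-scale a x 1≤a a≤x with m≤n⇒∃[o]m+o≡n a≤x
... | e , refl = go e
  where
  open ≤-Reasoning
  go : ∀ e → ∃ λ j → a * 2 ^ j ≤ a + e × a + e < a * 2 ^ suc j
  go zero = 0 , ≤-reflexive (lemma a) , (begin-strict
    a + 0       <⟨ +-monoʳ-< a 1≤a ⟩
    a + a       ≡⟨ lemma₂ a ⟩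
    a * (2 * 1) ∎)
    where
    lemma : ∀ a → a * 1 ≡ a + 0
    lemma = solve-∀
    lemma₂ : ∀ a → a + a ≡ a * (2 * 1)
    lemma₂ = solve-∀
  go (suc e) with go e
  ... | j , lo , hi with a + suc e <? a * 2 ^ suc j
  ...   | yes hi′ = j , ≤-trans lo (+-monoʳ-≤ a (n≤1+n e)) , hi′
  ...   | no ¬hi′ = suc j , ≮⇒≥ ¬hi′ , (begin-strict
    a + suc e                ≡⟨ +-suc a e ⟩
    suc (a + e)              ≤⟨ hi ⟩
    a * 2 ^ suc j            <⟨ m<m+n (a * 2 ^ suc j) (*-mono-≤ 1≤a (m^n>0 2 (suc j))) ⟩
    a * 2 ^ suc j + a * 2 ^ suc j  ≡⟨ lemma a (2 ^ suc j) ⟩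
    a * 2 ^ suc (suc j)      ∎)
    where
    lemma : ∀ a x → a * x + a * x ≡ a * (2 * x)
    lemma = solve-∀

log₂-bounds : ∀ d → 1 ≤ d → ∃ λ L → 2 ^ L ≤ d × d < 2 ^ suc L
log₂-bounds d 1≤d with dyadic-scale 1 d ≤-refl 1≤d
... | L , lo , hi = L , subst (_≤ d) (*-identityˡ (2 ^ L)) lo , subst (d <_) (*-identityˡ (2 ^ suc L)) hi

m<[1+m/n]*n : ∀ m n .{{_ : NonZero n}} → m < suc (m / n) * n
m<[1+m/n]*n m n = subst (_< suc (m / n) * n) (sym (m≡m%n+[m/n]*n m n)) (+-monoˡ-< (m / n * n) (m%n<n m n))

-- q 2^j is the least multiple of 2^j such that 3n q 2^j exceeds (L + 1) p; the scale 2^j ≈ L / 6n is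
-- coarse enough to bound q by a constant and fine enough to lose only a factor 1 - 1/n + o(1).
block-parameters : ∀ n p L → suc p ≤ n → 6 * n ≤ L →
  ∃₂ λ q j → let κ = q * 2 ^ j in
    suc L * p < 3 * n * κ × 6 * n * κ + L ≤ 2 * n * suc L × q ≤ 4 * n + 1 × 1 ≤ κ
block-parameters n p L p<n 6n≤L with dyadic-scale (6 * n) L 1≤6n 6n≤L
  where
  1≤6n : 1 ≤ 6 * n
  1≤6n = ≤-trans (≤-trans (s≤s z≤n) p<n) (m≤n*m n 6)
... | j , lo , hi = suc q′ , j , above , below , 1+q′≤ , *-mono-≤ {x = 1} {y = suc q′} (s≤s z≤n) (m^n>0 2 j)
  where
  open ≤-Reasoning
  w = 3 * n * 2 ^ j
  instance
    n≢0 : NonZero n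
    n≢0 = >-nonZero (≤-trans (s≤s z≤n) p<n)
    w≢0 : NonZero w
    w≢0 = m*n≢0 (3 * n) (2 ^ j) ⦃ m*n≢0 3 n ⦄ ⦃ m^n≢0 2 j ⦄
  q′ = (suc L * p) / w
  q′w≤ : q′ * w ≤ suc L * p
  q′w≤ = m/n*n≤m (suc L * p) w
  above : suc L * p < 3 * n * (suc q′ * 2 ^ j)
  above = begin-strict
    suc L * p                   <⟨ m<[1+m/n]*n (suc L * p) w ⟩
    suc q′ * w                  ≡⟨ lemma (suc q′) (3 * n) (2 ^ j) ⟩
    3 * n * (suc q′ * 2 ^ j)    ∎
    where
    lemma : ∀ q a x → q * (a * x) ≡ a * (q * x)
    lemma = solve-∀
  -- Divided by 2n: 3κ + L/(2n) ≤ L + 1. The margin L/(2n) in the exponent later pays for every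
  -- polynomial and constant factor.
  below : 6 * n * (suc q′ * 2 ^ j) + L ≤ 2 * n * suc L
  below = begin
    6 * n * (suc q′ * 2 ^ j) + L                       ≡⟨ lemma₁ n q′ (2 ^ j) L ⟩
    6 * n * 2 ^ j + 2 * (q′ * w) + L                   ≤⟨ +-monoˡ-≤ L (+-mono-≤ lo (*-monoʳ-≤ 2 q′w≤)) ⟩
    L + 2 * (suc L * p) + L                            ≤⟨ m≤m+n _ 2 ⟩
    L + 2 * (suc L * p) + L + 2                        ≡⟨ lemma₂ L p ⟩
    2 * suc p * suc L                                  ≤⟨ *-monoˡ-≤ (suc L) (*-monoʳ-≤ 2 p<n) ⟩
    2 * n * suc L                                      ∎
    where
    lemma₁ : ∀ n q x L → 6 * n * (suc q * x) + L ≡ 6 * n * x + 2 * (q * (3 * n * x)) + L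
    lemma₁ = solve-∀
    lemma₂ : ∀ L p → L + 2 * (suc L * p) + L + 2 ≡ 2 * suc p * suc L
    lemma₂ = solve-∀
  q′≤4n : q′ ≤ 4 * n
  q′≤4n = *-cancelʳ-≤ q′ (4 * n) w (begin
    q′ * w                      ≤⟨ q′w≤ ⟩
    suc L * p                   ≤⟨ *-mono-≤ hi (<⇒≤ p<n) ⟩
    6 * n * 2 ^ suc j * n       ≡⟨ lemma n (2 ^ j) ⟩
    4 * n * w                   ∎)
    where
    lemma : ∀ n x → 6 * n * (2 * x) * n ≡ 4 * n * (3 * n * x)
    lemma = solve-∀
  1+q′≤ : suc q′ ≤ 4 * n + 1
  1+q′≤ = ≤-trans (s≤s q′≤4n) (≤-reflexive (+-comm 1 (4 * n)))

blockCost : ℕ → ℕ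
blockCost n = (4 * n + 1) + (4 * n + 1) * (4 * n + 1)

-- The constants of twice `requiredDegree`: 64 = 2 · 16 · 2, a bound on 2^(q+q²) for q ≤ 4n + 1, the
-- coefficient of the polynomial, and the cube of 16n from `suc κ ≤ 16 * n * 2 ^ x`.
slack : ℕ → ℕ
slack n = 64 * 2 ^ blockCost n * (4 + blockCost n) * (16 * n) ^ 3

requiredDegree≤2^L : ∀ n q j L → 1 ≤ n → let κ = q * 2 ^ j in
  6 * n * κ + L ≤ 2 * n * suc L → q ≤ 4 * n + 1 → 8 * n * slack n ≤ L →
  requiredDegree κ (q * #min j ^ q) ((q * #max j) ^ q) (q * q + 2 * κ) ≤ 2 ^ L
-- Doubling the goal matches the exponent `suc L` that `below` provides.
requiredDegree≤2^L n q j L 1≤n below q≤ large = *-cancelˡ-≤ 2 (begin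
  2 * requiredDegree κ m M β
    ≤⟨ *-monoʳ-≤ 2 (*-mono-≤ (*-monoˡ-≤ 2 (*-mono-≤ (*-monoʳ-≤ 16 (*-monoˡ-≤ (suc κ) (#min-block≤ j q))) (#max-block≤ j q))) polynomial) ⟩
  2 * (16 * (2 ^ (q + κ) * suc κ) * 2 ^ β * 2 * ((4 + c) * suc κ ^ 2))
    ≡⟨ lemma₁ (2 ^ (q + κ)) (suc κ) (2 ^ β) (4 + c) ⟩
  2 ^ (q + κ) * 2 ^ β * (64 * (4 + c) * suc κ ^ 3)
    ≡⟨ cong (_* (64 * (4 + c) * suc κ ^ 3)) (trans (sym (^-distribˡ-+-* 2 (q + κ) β)) (trans (cong (2 ^_) (lemma₂ q κ)) (^-distribˡ-+-* 2 (q + q * q) (3 * κ)))) ⟩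
  2 ^ (q + q * q) * 2 ^ (3 * κ) * (64 * (4 + c) * suc κ ^ 3)
    ≤⟨ *-mono-≤ (*-monoˡ-≤ (2 ^ (3 * κ)) (^-monoʳ-≤ 2 q+q²≤c)) (*-monoʳ-≤ (64 * (4 + c)) (^-monoˡ-≤ 3 κ<)) ⟩
  2 ^ c * 2 ^ (3 * κ) * (64 * (4 + c) * (16 * n * 2 ^ x) ^ 3)
    ≡⟨ cong (λ y → 2 ^ c * 2 ^ (3 * κ) * (64 * (4 + c) * y)) (^-distribʳ-* (16 * n) (2 ^ x) 3) ⟩
  2 ^ c * 2 ^ (3 * κ) * (64 * (4 + c) * ((16 * n) ^ 3 * (2 ^ x) ^ 3))
    ≡⟨ lemma₃ 64 (2 ^ c) (2 ^ (3 * κ)) (4 + c) ((16 * n) ^ 3) ((2 ^ x) ^ 3) ⟩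
  2 ^ (3 * κ) * (2 ^ x) ^ 3 * slack n
    ≤⟨ *-monoʳ-≤ (2 ^ (3 * κ) * (2 ^ x) ^ 3) (≤-trans slack≤x (n≤2^n x)) ⟩
  2 ^ (3 * κ) * (2 ^ x) ^ 3 * 2 ^ x
    ≡⟨ lemma₄ (2 ^ (3 * κ)) (2 ^ x) ⟩
  2 ^ (3 * κ) * (2 ^ x) ^ 4
    ≡⟨ cong (2 ^ (3 * κ) *_) (^-*-assoc 2 x 4) ⟩
  2 ^ (3 * κ) * 2 ^ (x * 4)
    ≡⟨ ^-distribˡ-+-* 2 (3 * κ) (x * 4) ⟨
  2 ^ (3 * κ + x * 4)
    ≤⟨ ^-monoʳ-≤ 2 exponent ⟩
  2 ^ suc L ∎)
  where
  open ≤-Reasoning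
  κ = q * 2 ^ j
  m = q * #min j ^ q
  M = (q * #max j) ^ q
  β = q * q + 2 * κ
  c = blockCost n
  instance
    n≢0 : NonZero n
    n≢0 = >-nonZero 1≤n
    8n≢0 : NonZero (8 * n)
    8n≢0 = m*n≢0 8 n
    2n≢0 : NonZero (2 * n)
    2n≢0 = m*n≢0 2 n
  x = L / (8 * n)
  x8n≤L : x * (8 * n) ≤ L
  x8n≤L = m/n*n≤m L (8 * n)
  slack≤x : slack n ≤ x
  slack≤x = s≤s⁻¹ (*-cancelʳ-< (8 * n) (slack n) (suc x)
    (≤-<-trans (≤-reflexive (*-comm (slack n) (8 * n))) (≤-<-trans large (m<[1+m/n]*n L (8 * n)))))
  -- Of the four factors 2^x, three absorb `suc κ ^ 3` and one absorbs `slack n`; together they fit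
  -- the margin L/(2n).
  exponent : 3 * κ + x * 4 ≤ suc L
  exponent = *-cancelˡ-≤ (2 * n) (begin
    2 * n * (3 * κ + x * 4)      ≡⟨ lemma n κ x ⟩
    6 * n * κ + x * (8 * n)      ≤⟨ +-monoʳ-≤ (6 * n * κ) x8n≤L ⟩
    6 * n * κ + L                ≤⟨ below ⟩
    2 * n * suc L                ∎)
    where
    lemma : ∀ n κ x → 2 * n * (3 * κ + x * 4) ≡ 6 * n * κ + x * (8 * n)
    lemma = solve-∀
  q+q²≤c : q + q * q ≤ c
  q+q²≤c = +-mono-≤ q≤ (*-mono-≤ q≤ q≤)
  κ< : suc κ ≤ 16 * n * 2 ^ x
  κ< = begin
    suc κ                          ≤⟨ s≤s (≤-trans (m≤n*m κ 3) (≤-trans (m≤m+n (3 * κ) (x * 4)) exponent)) ⟩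
    suc (suc L)                    ≤⟨ s≤s (m<[1+m/n]*n L (8 * n)) ⟩
    1 + suc x * (8 * n)            ≤⟨ +-monoˡ-≤ (suc x * (8 * n)) (*-mono-≤ {x = 1} {y = suc x} (s≤s z≤n) (>-nonZero⁻¹ (8 * n))) ⟩
    suc x * (8 * n) + suc x * (8 * n) ≡⟨ lemma x n ⟩
    16 * n * (1 + x)               ≤⟨ *-monoʳ-≤ (16 * n) (n<2^n x) ⟩
    16 * n * 2 ^ x                 ∎
    where
    lemma : ∀ x n → suc x * (8 * n) + suc x * (8 * n) ≡ 16 * n * (1 + x)
    lemma = solve-∀
  polynomial : multiplicity κ + β + 3 ≤ (4 + c) * suc κ ^ 2
  polynomial = begin
    multiplicity κ + (q * q + 2 * κ) + 3          ≤⟨ +-monoˡ-≤ 3 (+-monoʳ-≤ (multiplicity κ) (+-monoˡ-≤ (2 * κ) (≤-trans (m≤n+m (q * q) q) q+q²≤c))) ⟩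
    κ * (3 * (κ + 2)) + (c + 2 * κ) + 3           ≤⟨ m≤m+n _ (κ * κ + 1 + c * (κ * κ + 2 * κ)) ⟩
    κ * (3 * (κ + 2)) + (c + 2 * κ) + 3 + (κ * κ + 1 + c * (κ * κ + 2 * κ)) ≡⟨ lemma κ c ⟩
    (4 + c) * suc κ ^ 2                           ∎
    where
    lemma : ∀ κ c → κ * (3 * (κ + 2)) + (c + 2 * κ) + 3 + (κ * κ + 1 + c * (κ * κ + 2 * κ)) ≡ (4 + c) * (suc κ * (suc κ * 1))
    lemma = solve-∀
  lemma₁ : ∀ a k b d → 2 * (16 * (a * k) * b * 2 * (d * (k * (k * 1)))) ≡ a * b * (64 * d * (k * (k * (k * 1))))
  lemma₁ = solve-∀
  lemma₂ : ∀ q κ → q + κ + (q * q + 2 * κ) ≡ q + q * q + 3 * κ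
  lemma₂ = solve-∀
  lemma₃ : ∀ e c k d n x → c * k * (e * d * (n * x)) ≡ k * x * (e * c * d * n)
  lemma₃ = solve-∀
  lemma₄ : ∀ k x → k * (x * (x * (x * 1))) * x ≡ k * (x * (x * (x * (x * 1))))
  lemma₄ = solve-∀

dichoosable⇒> : ∀ {N} {G : Graph N} {D : Orientation G} {κ k} → UncolourableLists D κ → Dichoosable D k → κ < k
dichoosable⇒> {κ = κ} {k} (L , valid , uncolourable) choosable with κ <? k
... | yes κ<k = κ<k
... | no  κ≮k = let φ , dicolouring = choosable L (valid k (≮⇒≥ κ≮k)) in contradiction dicolouring (uncolourable φ)

theorem1p3 : (m n : ℕ) → 1 ≤ m → 1 ≤ n →
    Σ ℕ λ d₀ → ∀ (N : ℕ) (G : Graph N) (d : ℕ) → MinDegree G d → d₀ ≤ d →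
    Σ (Orientation G) λ D → ∀ (k : ℕ) → Dichoosable D k → LogBound m n d k
theorem1p3 m n 1≤m 1≤n with n ≤? 3 * m
... | yes n≤3m = 0 , λ N G d _ _ → orientation G (λ _ → false) (replicate (N * N) zero) ,
  λ k _ → subst (λ e → d ^ e ≤ 2 ^ (3 * n * k)) (sym (m≤n⇒m∸n≡0 n≤3m)) (m^n>0 2 (3 * n * k))
... | no n≰3m = 2 ^ X , λ N G d minDegree d₀≤d → scaled G d minDegree d₀≤d (log₂-bounds d (≤-trans (m^n>0 2 X) d₀≤d))
  where
  open ≤-Reasoning
  -- The first summand makes `requiredDegree≤2^L` applicable, the second `block-parameters`.
  X = 8 * n * slack n + 6 * n
  p = n ∸ 3 * m
  p<n : p < n
  p<n = ∸-monoʳ-< {n} {3 * m} {0} (≤-trans 1≤m (m≤n*m m 3)) (<⇒≤ (≰⇒> n≰3m))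
  exponent≥X : ∀ {d L} → 2 ^ X ≤ d → d < 2 ^ suc L → X ≤ L
  exponent≥X {d} {L} d₀≤d d<2^[1+L] with X ≤? L
  ... | yes X≤L = X≤L
  ... | no  X≰L = contradiction (<-≤-trans d<2^[1+L] (≤-trans (^-monoʳ-≤ 2 (≰⇒> X≰L)) d₀≤d)) (<-irrefl refl)
  scaled : ∀ {N} (G : Graph N) d → MinDegree G d → 2 ^ X ≤ d → (∃ λ L → 2 ^ L ≤ d × d < 2 ^ suc L) →
    Σ (Orientation G) λ D → ∀ k → Dichoosable D k → LogBound m n d k
  scaled G d (degree≥d , v₀ , _) d₀≤d (L , 2^L≤d , d<2^[1+L]) =
    conclude (block-parameters n p L p<n (≤-trans (m≤n+m (6 * n) (8 * n * slack n)) X≤L))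
    where
    X≤L = exponent≥X d₀≤d d<2^[1+L]
    -- The hypothesis has `suc L` because d is rounded up to 2^(L+1) here, whereas the construction
    -- rounds it down to 2^L.
    bound : ∀ {κ} → suc L * p < 3 * n * κ →
      (Σ (Orientation G) λ D → UncolourableLists D κ) → Σ (Orientation G) λ D → ∀ k → Dichoosable D k → LogBound m n d k
    bound {κ} above (D , lists) = D , λ k choosable → begin
      d ^ p                  ≤⟨ ^-monoˡ-≤ p (<⇒≤ d<2^[1+L]) ⟩
      (2 ^ suc L) ^ p        ≡⟨ ^-*-assoc 2 (suc L) p ⟩
      2 ^ (suc L * p)        ≤⟨ ^-monoʳ-≤ 2 (<⇒≤ above) ⟩
      2 ^ (3 * n * κ)        ≤⟨ ^-monoʳ-≤ 2 (*-monoʳ-≤ (3 * n) (<⇒≤ (dichoosable⇒> {D = D} lists choosable))) ⟩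
      2 ^ (3 * n * k)        ∎
    conclude : (∃₂ λ q j → let κ = q * 2 ^ j in
      suc L * p < 3 * n * κ × 6 * n * κ + L ≤ 2 * n * suc L × q ≤ 4 * n + 1 × 1 ≤ κ) → _
    conclude (q , j , above , below , q≤ , 1≤κ) = bound above
      (gadget⇒uncolourable G (q * q + 2 * (q * 2 ^ j)) (block (tower j) q) 1≤κ (#max-block≤ j q) v₀ λ v →
        ≤-trans (requiredDegree≤2^L n q j L 1≤n below q≤ (≤-trans (m≤m+n (8 * n * slack n) (6 * n)) X≤L))
          (≤-trans 2^L≤d (degree≥d v)))
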